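{- For every $n\ge 5$, the wheel graph $W_n$ with $n$ vertices satisfies \[ \operatorname{nim}(\mathrm{DNT}(W_n))=\begin{cases} 0, & n \in \{18,38\} \text{ or } n \bmod 34 \in \{8,12,24,28,32\}\\ 1, & \text{otherwise}. \end{cases} \]
   Context: $W_n$ is the graph on $n$ vertices $v_1,\dots,v_{n-1},c$, where the center $c$ is adjacent to every $v_i$, and $v_i$ is adjacent to $v_{i+1}$ (indices modulo $n-1$). For a graph $G$ with vertex set $V$, a set $K\subseteq V$ is convex if it contains every vertex lying on any shortest path between two elements of $K$. The convex hull $[P]$ of $P\subseteq V$ is the smallest convex set containing $P$. The game $\mathrm{DNT}(G)$: positions are the sets $P\subseteq V$ with $[V\setminus P]=V$; the starting position is $\emptyset$; the options of $P$ are the sets $P\cup\{v\}$ with $v\in V\setminus P$ and $[V\setminus(P\cup\{v\})]=V$. The nim-value of a position is defined recursively by $\operatorname{nim}(p)=\operatorname{mex}\{\operatorname{nim}(q): q\text{ an option of }p\}$, where $\operatorname{mex}(A)$ is the smallest nonnegative integer not in $A$; the nim-value of a game is that of its starting position. -}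

module Defs where

open import Data.Bool.Properties using () renaming (_≟_ to _≟ᵇ_)
open import Data.Bool using (true)
import Data.Empty as Empty
open import Data.Fin using (Fin; zero; suc; toℕ)
open import Data.Fin.Properties using (_≟_; all?; any?; toℕ<n; toℕ-injective; injective⇒≤; nonZeroIndex)
open import Data.Fin.Subset using (Subset; ⊤; ⊥; ∁; _∪_; ⁅_⁆; _∈_; _∉_; _⊆_; ∣_∣)
open import Data.Fin.Subset.Properties
  using ( _∈?_; _⊆?_; anySubset?; ⊆-antisym; ⊆⊤; ∉⊥; p⊆p∪q; q⊆p∪q; x∈⁅x⁆
        ; x∉p⇒x∈∁p; p⊂q⇒∁p⊃∁q; p⊂q⇒∣p∣<∣q∣ )
open import Data.Irrelevant using ([_])
open import Data.List using (List; []; _∷_; length; map; concatMap; allFin; lookup)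
import Data.List.Membership.DecPropositional as DecMembership
open import Data.List.Membership.Propositional using (mapWith∈; lose)
  renaming (_∈_ to _∈ₗ_; _∉_ to _∉ₗ_)
open import Data.List.Membership.Propositional.Properties
  using (mapWith∈-cong; mapWith∈≗map; ∈-concatMap⁺; ∈-concatMap⁻; ∈-allFin)
open import Data.List.Relation.Unary.Any using (here; index; satisfied)
open import Data.List.Relation.Unary.Any.Properties using (lookup-index)
open import Data.Nat using (ℕ; zero; suc; _≤_; _<_; _+_; _%_; s≤s; s≤s⁻¹)
import Data.Nat.Properties as ℕ
open import Data.Nat.Induction using (<-wellFounded)
open import Data.Product using (_×_; _,_; ∃; ∃-syntax; proj₁; proj₂)
open import Data.Refinement using (Refinement; value; _,_)
open import Data.Sum using (_⊎_; inj₁; inj₂)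
import Data.Unit as Unit
import Data.Vec as Vec
open import Data.Vec using (Vec; []; _∷_)
import Data.Vec.Membership.DecPropositional as DecVecMembership
import Data.Vec.Membership.Propositional as VecMembership
import Data.Vec.Properties as Vec
open import Data.Vec.Relation.Unary.AllPairs using (allPairs?)
open import Data.Vec.Relation.Unary.Linked using (Linked; linked?)
open import Data.Vec.Relation.Unary.Unique.Propositional using (Unique)
open import Data.Vec.Relation.Unary.Unique.Propositional.Properties using (lookup-injective)
open import Function using (_∘_; _⇔_; mk⇔; module Equivalence)
open import Induction.WellFounded using (WellFounded; WfRec; module All; module FixPoint; module Subrelation)
open import Level using (0ℓ)
open import Relation.Binary using (Rel; Symmetric; Irreflexive)
import Relation.Binary as B
import Relation.Binary.Construct.On as On
open import Relation.Binary.PropositionalEquality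
  using (_≡_; _≢_; refl; sym; trans; cong; subst)
open import Relation.Nullary using (Dec; yes; no; ¬_; ¬?; does; map′; contradiction; recompute)
open import Relation.Nullary.Decidable using (_×-dec_; _⊎-dec_; _→-dec_; decidable-stable; dec-true)
open import Relation.Unary using (Pred; Decidable)

IsMex : List ℕ → ℕ → Set
IsMex xs k = k ∉ₗ xs × (∀ {j} → j < k → j ∈ₗ xs)

private
  initial⇒≤length : ∀ xs {k} → (∀ {j} → j < k → j ∈ₗ xs) → k ≤ length xs
  initial⇒≤length xs {k} below = injective⇒≤ {f = pos} pos-injective
    where
    pos : Fin k → Fin (length xs)
    pos i = index (below (toℕ<n i))

    pos-injective : ∀ {i j} → pos i ≡ pos j → i ≡ j
    pos-injective {i} {j} eq = toℕ-injective (trans (lookup-index (below (toℕ<n i)))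
      (trans (cong (lookup xs) eq) (sym (lookup-index (below (toℕ<n j))))))

  mex-search : ∀ xs fuel k → (∀ {j} → j < k → j ∈ₗ xs) → length xs < fuel + k → ∃ (IsMex xs)
  mex-search xs zero k below bound = contradiction (initial⇒≤length xs below) (ℕ.<⇒≱ bound)
  mex-search xs (suc fuel) k below bound with DecMembership._∈?_ ℕ._≟_ k xs
  ... | no  k∉xs = k , k∉xs , below
  ... | yes k∈xs = mex-search xs fuel (suc k) below′
                     (subst (length xs <_) (sym (ℕ.+-suc fuel k)) bound)
    where
    below′ : ∀ {j} → j < suc k → j ∈ₗ xs
    below′ j<1+k with ℕ.m≤n⇒m<n∨m≡n (s≤s⁻¹ j<1+k)
    ... | inj₁ j<k  = below j<k
    ... | inj₂ refl = k∈xs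

  mex-exists : ∀ xs → ∃ (IsMex xs)
  mex-exists xs = mex-search xs (suc (length xs)) 0 (λ ()) (s≤s (ℕ.m≤m+n (length xs) 0))

mex : List ℕ → ℕ
mex xs = proj₁ (mex-exists xs)

mex-isMex : ∀ xs → IsMex xs (mex xs)
mex-isMex xs = proj₂ (mex-exists xs)

record Game : Set₁ where
  field
    Position   : Set
    start      : Position
    options    : Position → List Position
    terminates : WellFounded (λ q p → q ∈ₗ options p)

module _ (G : Game) where
  open Game G

  private
    step : ∀ p → WfRec (λ q p → q ∈ₗ options p) (λ _ → ℕ) p → ℕ
    step p rec = mex (mapWith∈ (options p) rec)

  nim : Position → ℕ
  nim = All.wfRec terminates 0ℓ (λ _ → ℕ) step

  nim-unfold : ∀ p → nim p ≡ mex (map nim (options p))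
  nim-unfold p = trans
    (FixPoint.unfold-wfRec terminates (λ _ → ℕ) step
      (λ x eq → cong mex (mapWith∈-cong (options x) _ _ eq)))
    (cong mex (mapWith∈≗map nim (options p)))

  nimValue : ℕ
  nimValue = nim start

record Graph (n : ℕ) : Set₁ where
  field
    Adj    : Rel (Fin n) 0ℓ
    adj?   : B.Decidable Adj
    symm   : Symmetric Adj
    irrefl : Irreflexive _≡_ Adj

module _ {n : ℕ} (G : Graph n) where
  open Graph G
  open VecMembership using () renaming (_∈_ to _∈ᵥ_)

  -- A path with k edges is given by its k + 1 vertices.
  IsPath : ∀ {k} → Fin n → Fin n → Vec (Fin n) (suc k) → Set
  IsPath u w xs = Vec.head xs ≡ u × Vec.last xs ≡ w × Linked Adj xs × Unique xs

  IsShortestPath : ∀ {k} → Fin n → Fin n → Vec (Fin n) (suc k) → Set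
  IsShortestPath {k} u w xs =
    IsPath u w xs × (∀ {l} (ys : Vec (Fin n) (suc l)) → IsPath u w ys → k ≤ l)

  OnShortestPath : Fin n → Fin n → Fin n → Set
  OnShortestPath u w v =
    ∃[ k ] ∃[ xs ] (IsShortestPath {k} u w xs × v ∈ᵥ xs)

  Convex : Subset n → Set
  Convex K = ∀ u w v → u ∈ K → w ∈ K → OnShortestPath u w v → v ∈ K

  private
    anyVec? : ∀ k {P : Pred (Vec (Fin n) k) 0ℓ} → Decidable P → Dec (∃ P)
    anyVec? zero    P? = map′ (λ p → [] , p) (λ { ([] , p) → p }) (P? [])
    anyVec? (suc k) P? =
      map′ (λ { (x , xs , p) → x ∷ xs , p }) (λ { (x ∷ xs , p) → x , xs , p })
           (any? λ x → anyVec? k (P? ∘ (x ∷_)))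

  -- Opaque only to keep goals small when type checking clients.
  opaque
    isPath? : ∀ {k} u w → Decidable (IsPath {k} u w)
    isPath? u w xs =
      (Vec.head xs ≟ u) ×-dec (Vec.last xs ≟ w) ×-dec
      linked? adj? xs ×-dec allPairs? (λ x y → ¬? (x ≟ y)) xs

    isShortestPath? : ∀ {k} u w → Decidable (IsShortestPath {k} u w)
    isShortestPath? {k} u w xs = isPath? u w xs ×-dec
      map′ (λ ¬short {l} ys p → ℕ.≮⇒≥ λ l<k → ¬short (l , l<k , ys , p))
           (λ min (l , l<k , ys , p) → ℕ.<⇒≱ l<k (min ys p))
           (¬? (ℕ.anyUpTo? (λ l → anyVec? (suc l) (isPath? u w)) k))

    onShortestPath? : ∀ u w → Decidable (OnShortestPath u w)
    onShortestPath? u w v =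
      map′ (λ (k , _ , q) → k , q)
           (λ { (k , xs , q@((p , _) , _)) → k , bound p , xs , q })
           (ℕ.anyUpTo?
             (λ k → anyVec? (suc k) λ xs →
               isShortestPath? u w xs ×-dec DecVecMembership._∈?_ _≟_ v xs) n)
      where
      bound : ∀ {k} {xs : Vec (Fin n) (suc k)} → IsPath u w xs → k < n
      bound (_ , _ , _ , unique) = injective⇒≤ (lookup-injective unique _ _)

    convex? : Decidable Convex
    convex? K = all? λ u → all? λ w → all? λ v →
      (u ∈? K) →-dec (w ∈? K) →-dec onShortestPath? u w v →-dec (v ∈? K)

  InHull : Subset n → Fin n → Set
  InHull P v = ∀ K → Convex K → P ⊆ K → v ∈ K

  opaque
    inHull? : ∀ P → Decidable (InHull P)
    inHull? P v = map′ to from (¬? (anySubset? separates?))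
      where
      Separates : Pred (Subset n) 0ℓ
      Separates K = Convex K × P ⊆ K × v ∉ K

      separates? : Decidable Separates
      separates? K = convex? K ×-dec (P ⊆? K) ×-dec ¬? (v ∈? K)

      to : ¬ ∃ Separates → InHull P v
      to none K c P⊆K = decidable-stable (v ∈? K) λ v∉K → none (K , c , (λ {x} → P⊆K {x}) , v∉K)

      from : InHull P v → ¬ ∃ Separates
      from all (K , c , P⊆K , v∉K) = v∉K (all K c P⊆K)

  hull : Subset n → Subset n
  hull P = Vec.tabulate λ v → does (inHull? P v)

  ∈hull⇔ : ∀ P v → v ∈ hull P ⇔ InHull P v
  ∈hull⇔ P v = mk⇔ to from
    where
    does⁻ : ∀ {A : Set} (d : Dec A) → does d ≡ true → A
    does⁻ (yes a) _ = a

    to : v ∈ hull P → InHull P v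
    to v∈ = does⁻ (inHull? P v)
      (trans (sym (Vec.lookup∘tabulate (does ∘ inHull? P) v)) (Vec.[]=⇒lookup v∈))

    from : InHull P v → v ∈ hull P
    from h = Vec.lookup⇒[]= v (hull P)
      (trans (Vec.lookup∘tabulate (does ∘ inHull? P) v) (dec-true (inHull? P v) h))

  open Equivalence

  hull-smallestConvex : ∀ P →
    P ⊆ hull P × Convex (hull P) × (∀ K → Convex K → P ⊆ K → hull P ⊆ K)
  hull-smallestConvex P =
    (λ {x} x∈P → from (∈hull⇔ P x) λ K _ P⊆K → P⊆K x∈P) ,
    (λ u w v u∈ w∈ on → from (∈hull⇔ P v) λ K c P⊆K →
      c u w v (to (∈hull⇔ P u) u∈ K c P⊆K) (to (∈hull⇔ P w) w∈ K c P⊆K) on) ,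
    (λ K c P⊆K {x} x∈ → to (∈hull⇔ P x) x∈ K c P⊆K)

  Legal : Subset n → Set
  Legal P = hull (∁ P) ≡ ⊤

  legal? : Decidable Legal
  legal? P = Vec.≡-dec _≟ᵇ_ (hull (∁ P)) ⊤

  -- The legality proof is irrelevant, so positions are equal as soon as
  -- their underlying sets are.
  DNTPosition : Set
  DNTPosition = Refinement (Subset n) Legal

  private
    option : DNTPosition → Fin n → List DNTPosition
    option p v with ¬? (v ∈? value p) ×-dec legal? (value p ∪ ⁅ v ⁆)
    ... | yes (_ , legal) = ((value p ∪ ⁅ v ⁆) , [ legal ]) ∷ []
    ... | no  _           = []

    ∈-option⁻ : ∀ p q v → q ∈ₗ option p v → v ∉ value p × value q ≡ value p ∪ ⁅ v ⁆
    ∈-option⁻ p q v q∈ with ¬? (v ∈? value p) ×-dec legal? (value p ∪ ⁅ v ⁆)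
    ∈-option⁻ p q v (here refl) | yes (v∉p , _) = v∉p , refl
    ∈-option⁻ p q v ()          | no  _

    ∈-option⁺ : ∀ p q v → v ∉ value p → value q ≡ value p ∪ ⁅ v ⁆ → q ∈ₗ option p v
    ∈-option⁺ p (_ , [ legal ]) v v∉p refl
      with ¬? (v ∈? value p) ×-dec legal? (value p ∪ ⁅ v ⁆)
    ... | yes _  = here refl
    ... | no ¬ok = contradiction (v∉p , recompute (legal? _) legal) ¬ok

  dntOptions : DNTPosition → List DNTPosition
  dntOptions p = concatMap (option p) (allFin n)

  ∈-dntOptions⇔ : ∀ p q →
    q ∈ₗ dntOptions p ⇔ (∃[ v ] (v ∉ value p × value q ≡ value p ∪ ⁅ v ⁆))
  ∈-dntOptions⇔ p q = mk⇔
    (λ q∈ → let v , q∈v = satisfied (∈-concatMap⁻ (option p) {xs = allFin n} q∈)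
            in v , ∈-option⁻ p q v q∈v)
    (λ (v , v∉p , eq) → ∈-concatMap⁺ (option p) (lose (∈-allFin v) (∈-option⁺ p q v v∉p eq)))

  private
    ∅-legal : Legal ⊥
    ∅-legal = ⊆-antisym ⊆⊤ λ _ → proj₁ (hull-smallestConvex (∁ ⊥)) (x∉p⇒x∈∁p {p = ⊥} ∉⊥)

    option-decreases : ∀ {q p} → q ∈ₗ dntOptions p → ∣ ∁ (value q) ∣ < ∣ ∁ (value p) ∣
    option-decreases {q} {p} q∈ with to (∈-dntOptions⇔ p q) q∈
    ... | v , v∉p , refl = p⊂q⇒∣p∣<∣q∣ (p⊂q⇒∁p⊃∁q
            ( p⊆p∪q ⁅ v ⁆ , v , q⊆p∪q (value p) ⁅ v ⁆ (x∈⁅x⁆ v) , v∉p))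

  DNT : Game
  DNT = record
    { Position   = DNTPosition
    ; start      = ⊥ , [ ∅-legal ]
    ; options    = dntOptions
    ; terminates = Subrelation.wellFounded option-decreases
                     (On.wellFounded (λ p → ∣ ∁ (value p) ∣) <-wellFounded)
    }

CyclicSuc : ∀ {m} → Rel (Fin m) 0ℓ
CyclicSuc {m} i j = toℕ j ≡ _%_ (suc (toℕ i)) m {{nonZeroIndex i}}

-- zero is the center, the vertices suc i form the rim.
-- The condition i ≢ j only excludes the loop that a one-vertex rim would have.
WheelAdj : ∀ {n} → Rel (Fin n) 0ℓ
WheelAdj zero    zero    = Empty.⊥
WheelAdj zero    (suc _) = Unit.⊤
WheelAdj (suc _) zero    = Unit.⊤
WheelAdj (suc i) (suc j) = i ≢ j × (CyclicSuc i j ⊎ CyclicSuc j i)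

wheel : ∀ n → Graph n
wheel n = record
  { Adj    = WheelAdj
  ; adj?   = adj?
  ; symm   = λ {x} {y} → symm x y
  ; irrefl = λ {x} {y} → irrefl x y
  }
  where
  adj? : ∀ {n} → B.Decidable (WheelAdj {n})
  adj? zero    zero    = no λ ()
  adj? zero    (suc _) = yes _
  adj? (suc _) zero    = yes _
  adj? (suc i) (suc j) = ¬? (i ≟ j) ×-dec ((_ ℕ.≟ _) ⊎-dec (_ ℕ.≟ _))

  symm : ∀ {n} (x y : Fin n) → WheelAdj x y → WheelAdj y x
  symm zero    (suc _) _             = _
  symm (suc _) zero    _             = _
  symm (suc _) (suc _) (i≢j , inj₁ s) = i≢j ∘ sym , inj₂ s
  symm (suc _) (suc _) (i≢j , inj₂ s) = i≢j ∘ sym , inj₁ s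

  irrefl : ∀ {n} (x y : Fin n) → x ≡ y → ¬ WheelAdj x y
  irrefl (suc i) (suc .i) refl (i≢i , _) = i≢i refl

{-# OPTIONS --safe #-}

-- For n ≥ 5 a set P is a position of DNT(Wₙ) exactly when no two cyclically
-- adjacent rim vertices belong to P: if i and i + 1 do, V ∖ {i, i + 1} is
-- convex; otherwise every taken rim vertex lies between two free ones on a
-- shortest path, and so does the center.  Hence the game is node Kayles on the
-- rim plus one extra move, the center.  Cutting the rim open at a taken vertex
-- leaves gaps between taken vertices; a move in a gap of s vertices splits it
-- into nonempty gaps p and q with p + 1 + q = s, so by Sprague–Grundy the
-- nim-value of a position is the nim-sum of the values of its gaps, and these
-- are the values of Dawson's Kayles on s ∸ 2 vertices.  They have period 34 from
-- s = 54 on.  The center plays the role of one more gap of size 3.  The start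
-- position has value 0 exactly when a gap of size n ∸ 2 has value 0.

module Submission where

open import Defs
open import Data.Bool using (Bool; true; false; T; _xor_; if_then_else_)
import Data.Bool.Properties as Bool
open import Data.Empty using () renaming (⊥ to Empty)
open import Data.Fin as Fin using (Fin; zero; suc; toℕ; fromℕ<)
open import Data.Fin.Properties as Fin
  using (toℕ-fromℕ<; toℕ<n; toℕ-injective; nonZeroIndex)
open import Data.Fin.Subset using (Subset; ∁; _∪_; ⁅_⁆; _⊆_)
  renaming (⊥ to ∅; _∈_ to _∈ₛ_; _∉_ to _∉ₛ_)
open import Data.Fin.Subset.Properties
  using ( ∈⊤; ⊆⊤; ∉⊥; ⊆-antisym; x∈∁p⇒x∉p; x∉p⇒x∈∁p; x∈⁅x⁆; x∈⁅y⁆⇒x≡y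
        ; x∈p∪q⁺; x∈p∪q⁻; ∪-identityˡ; ∪-identityʳ )
  renaming (_∈?_ to _∈ₛ?_)
open import Data.Irrelevant using ([_])
open import Data.List using ([]; _∷_)
open import Data.List as List using (List; _++_)
open import Data.List.Membership.Propositional using (_∈_)
open import Data.List.Membership.Propositional using (_∉_)
open import Data.List.Membership.Propositional.Properties using (∈-map⁺; ∈-map⁻)
import Data.List.Properties as List
open import Data.List.Relation.Unary.Any using (here; there)
open import Data.List.Relation.Unary.Linked as Linked using (Linked; []; [-]; _∷_)
open import Data.Nat using (ℕ; _≤_; _%_)
open import Data.Nat
  using ( zero; suc; pred; _+_; _*_; _∸_; _^_; _/_; _<_; _<ᵇ_; _≡ᵇ_; _≤?_; _<?_
        ; z≤n; s≤s; s≤s⁻¹ )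
open import Data.Nat.DivMod using (m≡m%n+[m/n]*n; m%n<n; [m+kn]%n≡m%n; m<n⇒m%n≡m; n%n≡0)
import Data.Nat.Properties as ℕ
open import Data.List.Membership.DecPropositional ℕ._≟_ using (_∈?_)
open import Data.Product using (_×_)
open import Data.Product using (_,_; ∃-syntax; proj₁; proj₂)
open import Data.Refinement using (value; _,_)
open import Data.Refinement.Properties using (value-injective)
open import Data.Sum using (_⊎_)
open import Data.Sum using (inj₁; inj₂; [_,_]′)
open import Data.Unit using (tt)
open import Data.Vec as Vec using (Vec; []; _∷_; here; there; lookup; toList; zipWith)
import Data.Vec.Properties as Vec
open import Data.Vec.Relation.Unary.All using ([]; _∷_)
open import Data.Vec.Relation.Unary.AllPairs using ([]; _∷_)
open import Data.Vec.Relation.Unary.Any using (here; there)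
open import Data.Vec.Relation.Unary.Linked using ([-]; _∷_)
open import Function using (_∘_; _⇔_; mk⇔; module Equivalence)
open import Induction.WellFounded using (module All)
open import Level using (0ℓ)
open import Relation.Binary.Definitions using (tri<; tri≈; tri>)
open import Relation.Binary.PropositionalEquality using (_≡_)
open import Relation.Binary.PropositionalEquality
  using (_≢_; refl; sym; trans; cong; cong₂; subst; subst₂; module ≡-Reasoning)
open import Relation.Nullary using (¬_)
open import Relation.Nullary using (Dec; yes; no; ¬?; contradiction; recompute)
open import Relation.Nullary.Decidable using (_→-dec_; _×-dec_; _⊎-dec_; toWitness)

-- Nim-sums of fixed-length binary numbers

-- Binary expansions of fixed length, most significant digit first.
Nimber : ℕ → Set
Nimber = Vec Bool

infixl 6 _⊕_
_⊕_ : ∀ {k} → Nimber k → Nimber k → Nimber k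
_⊕_ = zipWith _xor_

⊕-comm : ∀ {k} (a b : Nimber k) → a ⊕ b ≡ b ⊕ a
⊕-comm = Vec.zipWith-comm Bool.xor-comm

⊕-assoc : ∀ {k} (a b c : Nimber k) → (a ⊕ b) ⊕ c ≡ a ⊕ (b ⊕ c)
⊕-assoc = Vec.zipWith-assoc Bool.xor-assoc

⊕-selfInverse : ∀ {k} (a b : Nimber k) → a ⊕ (a ⊕ b) ≡ b
⊕-selfInverse []      []      = refl
⊕-selfInverse (a ∷ x) (b ∷ y) = cong₂ _∷_
  (trans (sym (Bool.xor-assoc a a b)) (cong (_xor b) (Bool.xor-same a))) (⊕-selfInverse x y)

⊕-cancelˡ : ∀ {k} (a : Nimber k) {b c} → a ⊕ b ≡ a ⊕ c → b ≡ c
⊕-cancelˡ a {b} {c} eq =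
  trans (sym (⊕-selfInverse a b)) (trans (cong (a ⊕_) eq) (⊕-selfInverse a c))

⊕-cancelʳ : ∀ {k} {a b : Nimber k} (c : Nimber k) → a ⊕ c ≡ b ⊕ c → a ≡ b
⊕-cancelʳ {a = a} {b} c eq = ⊕-cancelˡ c (trans (⊕-comm c a) (trans eq (⊕-comm b c)))

infix 4 _≺_
-- The lengths agree, so this lexicographic order is the order of the values `⟦_⟧`. It is given
-- through the first differing digit because that is where nim-sums can be controlled.
data _≺_ : ∀ {k} → Nimber k → Nimber k → Set where
  f≺t : ∀ {k} {x y : Nimber k} → (false ∷ x) ≺ (true ∷ y)
  b∷_ : ∀ {k} {x y : Nimber k} {b} → x ≺ y → (b ∷ x) ≺ (b ∷ y)

-- At the first digit where `c` differs from `a ⊕ b` the latter has a 1, so exactly one of `a` and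
-- `b` has a 1 there. That one can be lowered to the nim-sum of `c` with the other. This is the
-- Sprague-Grundy argument for moves in a sum of games.
≺-⊕ : ∀ {k} (a b : Nimber k) {c} → c ≺ a ⊕ b →
  (∃[ a′ ] (a′ ≺ a × a′ ⊕ b ≡ c)) ⊎ (∃[ b′ ] (b′ ≺ b × a ⊕ b′ ≡ c))
≺-⊕ (true  ∷ a) (false ∷ b) {_ ∷ c} f≺t =
  inj₁ (false ∷ (b ⊕ c) , f≺t , cong (false ∷_) (trans (⊕-comm (b ⊕ c) b) (⊕-selfInverse b c)))
≺-⊕ (false ∷ a) (true  ∷ b) {_ ∷ c} f≺t =
  inj₂ (false ∷ (a ⊕ c) , f≺t , cong (false ∷_) (⊕-selfInverse a c))
≺-⊕ (u ∷ a) (v ∷ b) (b∷ c≺) with ≺-⊕ a b c≺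
... | inj₁ (a′ , a′≺ , eq) = inj₁ (u ∷ a′ , b∷ a′≺ , cong ((u xor v) ∷_) eq)
... | inj₂ (b′ , b′≺ , eq) = inj₂ (v ∷ b′ , b∷ b′≺ , cong ((u xor v) ∷_) eq)

⟦_⟧ : ∀ {k} → Nimber k → ℕ
⟦ [] ⟧ = 0
⟦_⟧ {suc k} (true  ∷ x) = 2 ^ k + ⟦ x ⟧
⟦_⟧ {suc k} (false ∷ x) = ⟦ x ⟧

⟦⟧<2^ : ∀ {k} (x : Nimber k) → ⟦ x ⟧ < 2 ^ k
⟦⟧<2^ [] = s≤s z≤n
⟦⟧<2^ {suc k} (true  ∷ x) = ℕ.+-monoʳ-< (2 ^ k) (ℕ.<-≤-trans (⟦⟧<2^ x) (ℕ.m≤m+n _ 0))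
⟦⟧<2^ {suc k} (false ∷ x) = ℕ.<-≤-trans (⟦⟧<2^ x) (ℕ.m≤m+n _ _)

⟦⟧-injective : ∀ {k} (x y : Nimber k) → ⟦ x ⟧ ≡ ⟦ y ⟧ → x ≡ y
⟦⟧-injective [] [] _ = refl
⟦⟧-injective {suc k} (true  ∷ x) (true  ∷ y) eq =
  cong (true ∷_) (⟦⟧-injective x y (ℕ.+-cancelˡ-≡ (2 ^ k) _ _ eq))
⟦⟧-injective (false ∷ x) (false ∷ y) eq = cong (false ∷_) (⟦⟧-injective x y eq)
⟦⟧-injective {suc k} (true  ∷ x) (false ∷ y) eq =
  contradiction (subst (_< 2 ^ k) (sym eq) (⟦⟧<2^ y)) (ℕ.m+n≮m (2 ^ k) ⟦ x ⟧)
⟦⟧-injective {suc k} (false ∷ x) (true  ∷ y) eq =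
  contradiction (subst (_< 2 ^ k) eq (⟦⟧<2^ x)) (ℕ.m+n≮m (2 ^ k) ⟦ y ⟧)

bits : ∀ k → ℕ → Nimber k
bits zero    n = []
bits (suc k) n = if n <ᵇ 2 ^ k then false ∷ bits k n else true ∷ bits k (n ∸ 2 ^ k)

⟦bits⟧ : ∀ k {n} → n < 2 ^ k → ⟦ bits k n ⟧ ≡ n
⟦bits⟧ zero    {zero} _ = refl
⟦bits⟧ zero    {suc _} (s≤s ())
⟦bits⟧ (suc k) {n} n< with n <ᵇ 2 ^ k in eq
... | true  = ⟦bits⟧ k (ℕ.<ᵇ⇒< n (2 ^ k) (subst T (sym eq) tt))
... | false = trans (cong (2 ^ k +_) (⟦bits⟧ k n∸<)) (ℕ.m+[n∸m]≡n n≥)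
  where
  n≥ : 2 ^ k ≤ n
  n≥ = ℕ.≮⇒≥ λ lt → subst T eq (ℕ.<⇒<ᵇ lt)
  n∸< : n ∸ 2 ^ k < 2 ^ k
  n∸< = ℕ.+-cancelˡ-< (2 ^ k) _ _ (subst₂ _<_ (sym (ℕ.m+[n∸m]≡n n≥))
          (cong (2 ^ k +_) (ℕ.+-identityʳ (2 ^ k))) n<)

below⟦⟧ : ∀ {k} (x : Nimber k) {j} → j < ⟦ x ⟧ → ∃[ y ] (y ≺ x × ⟦ y ⟧ ≡ j)
below⟦⟧ {suc k} (false ∷ x) j< with below⟦⟧ x j<
... | y , y≺ , eq = false ∷ y , b∷ y≺ , eq
below⟦⟧ {suc k} (true ∷ x) {j} j< with j <? 2 ^ k
... | yes j<2^k = false ∷ bits k j , f≺t , ⟦bits⟧ k j<2^k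
... | no  j≮2^k with below⟦⟧ x {j ∸ 2 ^ k} (ℕ.+-cancelˡ-< (2 ^ k) _ _
                      (subst (_< 2 ^ k + ⟦ x ⟧) (sym (ℕ.m+[n∸m]≡n (ℕ.≮⇒≥ j≮2^k))) j<))
... | y , y≺ , eq = true ∷ y , b∷ y≺ ,
                    trans (cong (2 ^ k +_) eq) (ℕ.m+[n∸m]≡n (ℕ.≮⇒≥ j≮2^k))

≺⇒⟦⟧< : ∀ {k} {x y : Nimber k} → x ≺ y → ⟦ x ⟧ < ⟦ y ⟧
≺⇒⟦⟧< {suc k} {x = _ ∷ x} {y = _ ∷ y} f≺t = ℕ.<-≤-trans (⟦⟧<2^ x) (ℕ.m≤m+n (2 ^ k) ⟦ y ⟧)
≺⇒⟦⟧< {suc k} (b∷_ {b = true}  x≺y) = ℕ.+-monoʳ-< (2 ^ k) (≺⇒⟦⟧< x≺y)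
≺⇒⟦⟧< {suc k} (b∷_ {b = false} x≺y) = ≺⇒⟦⟧< x≺y

-- Moves on words and the nim-sum of their gaps

infix 4 _↗_
-- A move: `true` marks a taken vertex, and one free vertex becomes taken.
data _↗_ : List Bool → List Bool → Set where
  here  : ∀ {l} → (false ∷ l) ↗ (true ∷ l)
  there : ∀ {b l l′} → l ↗ l′ → (b ∷ l) ↗ (b ∷ l′)

NotBoth : Bool → Bool → Set
NotBoth a b = ¬ (a ≡ true × b ≡ true)

-- The word l is delimited by a taken vertex on the right and, on the left, by
-- a taken vertex followed by s free ones.
Fits : ℕ → List Bool → Set
Fits s l = Linked NotBoth ((s ≡ᵇ 0) ∷ l ++ true ∷ [])

Fits-∷⁺ : ∀ {s l} → 1 ≤ s → Fits 0 l → Fits s (true ∷ l)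
Fits-∷⁺ (s≤s _) fits = (λ ()) ∷ fits

Fits-∷⁻ : ∀ s {l} → Fits s (true ∷ l) → 1 ≤ s × Fits 0 l
Fits-∷⁻ zero    (¬both ∷ _) = contradiction (refl , refl) ¬both
Fits-∷⁻ (suc _) (_ ∷ fits) = s≤s z≤n , fits

Fits-[] : ∀ s → Fits s [] → 1 ≤ s
Fits-[] zero    (¬both ∷ _) = contradiction (refl , refl) ¬both
Fits-[] (suc _) _           = s≤s z≤n

Fits-false : ∀ {s l} → Fits (suc s) l → Fits s (false ∷ l)
Fits-false fits = (λ ()) ∷ fits

-- Together the two laws say that `gap s` is the mex of the values of all splittings of `s` into two
-- nonempty gaps. Stating them as properties lets a finite table with a periodic tail provide the
-- values.
record GapValues (k : ℕ) : Set where
  field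
    gap          : ℕ → Nimber k
    gap-excludes : ∀ {p q} → 1 ≤ p → 1 ≤ q → gap (p + suc q) ≢ gap p ⊕ gap q
    gap-attains  : ∀ s {c} → c ≺ gap s →
      ∃[ p ] ∃[ q ] (1 ≤ p × 1 ≤ q × p + suc q ≡ s × gap p ⊕ gap q ≡ c)

module Words {k : ℕ} (G : GapValues k) where
  open GapValues G

  word : ℕ → List Bool → Nimber k
  word s []          = gap s
  word s (false ∷ l) = word (suc s) l
  word s (true  ∷ l) = gap s ⊕ word 0 l

  -- The two sides differ only in the gap that the new taken vertex splits. The word is scanned,
  -- with `q` counting free vertices behind that vertex, until the gap ends; the common rest cancels
  -- and `gap-excludes` applies.
  word-∷-excludes : ∀ s q l → 1 ≤ s → Fits q l → word (s + suc q) l ≢ gap s ⊕ word q l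
  word-∷-excludes s q []          1≤s fits = gap-excludes 1≤s (Fits-[] q fits)
  word-∷-excludes s q (false ∷ l) 1≤s fits =
    subst (λ t → word t l ≢ gap s ⊕ word (suc q) l) (ℕ.+-suc s (suc q))
      (word-∷-excludes s (suc q) l 1≤s (Linked.tail fits))
  word-∷-excludes s q (true  ∷ l) 1≤s fits eq =
    gap-excludes 1≤s (proj₁ (Fits-∷⁻ q fits))
      (⊕-cancelʳ (word 0 l) (trans eq (sym (⊕-assoc (gap s) (gap q) (word 0 l)))))

  word-excludes : ∀ s {l l′} → l ↗ l′ → Fits s l′ → word s l′ ≢ word s l
  word-excludes s {false ∷ l} here fits eq with Fits-∷⁻ s fits
  ... | 1≤s , fits₀ = word-∷-excludes s 0 l 1≤s fits₀
                        (trans (cong (λ t → word t l) (ℕ.+-comm s 1)) (sym eq))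
  word-excludes s {false ∷ l} (there l↗l′) fits eq =
    word-excludes (suc s) l↗l′ (Linked.tail fits) eq
  word-excludes s {true ∷ l} (there l↗l′) fits eq =
    word-excludes 0 l↗l′ (proj₂ (Fits-∷⁻ s fits)) (⊕-cancelˡ (gap s) eq)

  -- Either the move is made inside l, or it splits the s free vertices before
  -- l into p and q.
  word-attains′ : ∀ s l {c} → Fits s l → c ≺ word s l →
    (∃[ l′ ] (l ↗ l′ × Fits s l′ × word s l′ ≡ c)) ⊎
    (∃[ p ] ∃[ q ] (1 ≤ p × p + suc q ≡ s × Fits q l × gap p ⊕ word q l ≡ c))
  word-attains′ s [] fits c≺ with gap-attains s c≺
  ... | p , suc q , 1≤p , s≤s _ , eq , c≡ = inj₂ (p , suc q , 1≤p , eq , (λ ()) ∷ [-] , c≡)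
  word-attains′ s (false ∷ l) fits c≺ with word-attains′ (suc s) l (Linked.tail fits) c≺
  ... | inj₁ (l′ , l↗l′ , fits′ , c≡) = inj₁ (false ∷ l′ , there l↗l′ , Fits-false {s} fits′ , c≡)
  -- With `q` zero the vertex to take is the `false` just read, so the move lies inside the word.
  -- Otherwise it lies further left, and this `false` is handed back from the gap behind it to the
  -- word.
  ... | inj₂ (p , zero , 1≤p , eq , fits′ , c≡)
        with refl ← ℕ.suc-injective (trans (ℕ.+-comm 1 p) eq) =
        inj₁ (true ∷ l , here , Fits-∷⁺ 1≤p fits′ , c≡)
  ... | inj₂ (p , suc q , 1≤p , eq , fits′ , c≡) =
        inj₂ (p , q , 1≤p , ℕ.suc-injective (trans (sym (ℕ.+-suc p (suc q))) eq) ,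
              Fits-false {q} fits′ , c≡)
  word-attains′ s (true ∷ l) fits c≺ with Fits-∷⁻ s fits | ≺-⊕ (gap s) (word 0 l) c≺
  ... | 1≤s , fits₀ | inj₁ (a , a≺ , refl) with gap-attains s a≺
  ... | p , q , 1≤p , 1≤q , eq , refl =
        inj₂ (p , q , 1≤p , eq , Fits-∷⁺ 1≤q fits₀ , sym (⊕-assoc (gap p) (gap q) (word 0 l)))
  word-attains′ s (true ∷ l) fits c≺ | 1≤s , fits₀ | inj₂ (b , b≺ , refl)
    with word-attains′ 0 l fits₀ b≺
  ... | inj₁ (l′ , l↗l′ , fits′ , refl) = inj₁ (true ∷ l′ , there l↗l′ , Fits-∷⁺ 1≤s fits′ , refl)
  ... | inj₂ (p , q , _ , eq , _) = contradiction (trans (sym (ℕ.+-suc p q)) eq) λ ()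

  word-attains : ∀ l {c} → Fits 0 l → c ≺ word 0 l → ∃[ l′ ] (l ↗ l′ × Fits 0 l′ × word 0 l′ ≡ c)
  word-attains l fits c≺ with word-attains′ 0 l fits c≺
  ... | inj₁ found = found
  ... | inj₂ (p , q , _ , eq , _) = contradiction (trans (sym (ℕ.+-suc p q)) eq) λ ()

  word-zeros : ∀ s a l → word s (List.replicate a false ++ l) ≡ word (a + s) l
  word-zeros s zero    l = refl
  word-zeros s (suc a) l = trans (word-zeros (suc s) a l) (cong (λ t → word t l) (ℕ.+-suc a s))

-- Dawson's Kayles: values and periodicity

nth : List ℕ → ℕ → ℕ
nth []       _       = 0
nth (x ∷ xs) zero    = x
nth (x ∷ xs) (suc i) = nth xs i

-- Values of gaps of size s: dawson-initial for s < 54, and from there on the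
-- entry of dawson-period at s % 34.
dawson-initial dawson-period : List ℕ
dawson-initial =
  0 ∷ 0 ∷ 0 ∷ 1 ∷ 1 ∷ 2 ∷ 0 ∷ 3 ∷ 1 ∷ 1 ∷ 0 ∷ 3 ∷ 3 ∷ 2 ∷ 2 ∷ 4 ∷ 0 ∷
  5 ∷ 2 ∷ 2 ∷ 3 ∷ 3 ∷ 0 ∷ 1 ∷ 1 ∷ 3 ∷ 0 ∷ 2 ∷ 1 ∷ 1 ∷ 0 ∷ 4 ∷ 5 ∷ 2 ∷
  7 ∷ 4 ∷ 0 ∷ 1 ∷ 1 ∷ 2 ∷ 0 ∷ 3 ∷ 1 ∷ 1 ∷ 0 ∷ 3 ∷ 3 ∷ 2 ∷ 2 ∷ 4 ∷ 4 ∷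
  5 ∷ 5 ∷ 2 ∷ []
dawson-period =
  7 ∷ 4 ∷ 8 ∷ 1 ∷ 1 ∷ 2 ∷ 0 ∷ 3 ∷ 1 ∷ 1 ∷ 0 ∷ 3 ∷ 3 ∷ 2 ∷ 2 ∷ 4 ∷ 4 ∷
  5 ∷ 5 ∷ 9 ∷ 3 ∷ 3 ∷ 0 ∷ 1 ∷ 1 ∷ 3 ∷ 0 ∷ 2 ∷ 1 ∷ 1 ∷ 0 ∷ 4 ∷ 5 ∷ 3 ∷ []

dawsonTable : ℕ → Nimber 4
-- Four digits suffice, as no entry exceeds 9.
dawsonTable s = bits 4 (if s <ᵇ 54 then nth dawson-initial s else nth dawson-period (s % 34))

infix 4 _≟ⁿ_
_≟ⁿ_ : ∀ {k} (x y : Nimber k) → Dec (x ≡ y)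
_≟ⁿ_ = Vec.≡-dec Bool._≟_

-- From 88 = 54 + 34 on, p and q can be reduced by 34 without changing any value.
dawsonTable-excludes-small : ∀ {p} → p < 88 → 1 ≤ p → ∀ {q} → q < 88 → 1 ≤ q →
  dawsonTable (p + suc q) ≢ dawsonTable p ⊕ dawsonTable q
dawsonTable-excludes-small = toWitness {a? =
  ℕ.allUpTo? (λ p → 1 ≤? p →-dec
    ℕ.allUpTo? (λ q → 1 ≤? q →-dec
      ¬? (dawsonTable (p + suc q) ≟ⁿ dawsonTable p ⊕ dawsonTable q)) 88) 88} tt

-- 142 = 2 * 54 + 34: if p + 1 + q ≥ 2 * 54, then p or q is at least 54 and can be
-- increased by multiples of 34.
dawsonTable-attains-small : ∀ {s} → s < 142 → ∀ {j} → j < ⟦ dawsonTable s ⟧ → ∃[ p ] (p < s ×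
  1 ≤ p × 1 ≤ s ∸ suc p × dawsonTable p ⊕ dawsonTable (s ∸ suc p) ≡ bits 4 j)
dawsonTable-attains-small = toWitness {a? =
  ℕ.allUpTo? (λ s → ℕ.allUpTo? (λ j → ℕ.anyUpTo? (λ p → 1 ≤? p ×-dec 1 ≤? s ∸ suc p ×-dec
    dawsonTable p ⊕ dawsonTable (s ∸ suc p) ≟ⁿ bits 4 j) s) ⟦ dawsonTable s ⟧) 142} tt

Exceptional : ℕ → Set
Exceptional n = n ∈ (18 ∷ 38 ∷ []) ⊎ n % 34 ∈ (8 ∷ 12 ∷ 24 ∷ 28 ∷ 32 ∷ [])

exceptional? : ∀ n → Dec (Exceptional n)
exceptional? n = (n ∈? _) ⊎-dec (n % 34 ∈? _)

-- The bound 88 = 54 + 34 covers the initial segment and one full period. A gap of size `s` belongs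
-- to the wheel with `2 + s` vertices.
dawsonTable-zero : ∀ {s} → s < 88 → 3 ≤ s →
  (Exceptional (2 + s) → ⟦ dawsonTable s ⟧ ≡ 0) × (⟦ dawsonTable s ⟧ ≡ 0 → Exceptional (2 + s))
dawsonTable-zero = toWitness {a? = ℕ.allUpTo? (λ s → 3 ≤? s →-dec
  ((exceptional? (2 + s) →-dec ⟦ dawsonTable s ⟧ ℕ.≟ 0) ×-dec
   (⟦ dawsonTable s ⟧ ℕ.≟ 0 →-dec exceptional? (2 + s)))) 88} tt

-- Opaque because on open terms the table unfolds into very large normal forms.
opaque
  dawson : ℕ → Nimber 4
  dawson = dawsonTable

  dawson-shift : ∀ {p} k → 54 ≤ p → dawson (p + k * 34) ≡ dawson p
  -- Once `p` is written as 54 + (p ∸ 54), the test `<ᵇ 54` computes to `false` on both sides and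
  -- only the residue modulo 34 is left to compare.
  dawson-shift {p} k 54≤p = subst (λ m → dawsonTable (m + k * 34) ≡ dawsonTable m)
    (ℕ.m+[n∸m]≡n 54≤p)
    (cong (bits 4 ∘ nth dawson-period) ([m+kn]%n≡m%n (54 + (p ∸ 54)) k 34))

  dawson-excludes-small : ∀ {p} → p < 88 → 1 ≤ p → ∀ {q} → q < 88 → 1 ≤ q →
    dawson (p + suc q) ≢ dawson p ⊕ dawson q
  dawson-excludes-small = dawsonTable-excludes-small

  dawson-attains-small : ∀ {s} → s < 142 → ∀ {j} → j < ⟦ dawson s ⟧ → ∃[ p ] (p < s ×
    1 ≤ p × 1 ≤ s ∸ suc p × dawson p ⊕ dawson (s ∸ suc p) ≡ bits 4 j)
  dawson-attains-small = dawsonTable-attains-small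

  dawson-zero-small : ∀ {s} → s < 88 → 3 ≤ s →
    (Exceptional (2 + s) → ⟦ dawson s ⟧ ≡ 0) × (⟦ dawson s ⟧ ≡ 0 → Exceptional (2 + s))
  dawson-zero-small = dawsonTable-zero

  dawson-3 : dawson 3 ≡ bits 4 1
  dawson-3 = refl

opaque
  reduce-mod34 : ∀ d {s} → d ≤ s → ∃[ r ] ∃[ k ] (d ≤ r × r < d + 34 × s ≡ r + k * 34)
  reduce-mod34 d {s} d≤s = d + u % 34 , u / 34 , ℕ.m≤m+n d _ , ℕ.+-monoʳ-< d (m%n<n u 34) ,
    (begin
      s                          ≡⟨ ℕ.m+[n∸m]≡n d≤s ⟨
      d + u                      ≡⟨ cong (d +_) (m≡m%n+[m/n]*n u 34) ⟩
      d + (u % 34 + u / 34 * 34) ≡⟨ ℕ.+-assoc d (u % 34) _ ⟨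
      d + u % 34 + u / 34 * 34   ∎)
    where
    open ≡-Reasoning
    u : ℕ
    u = s ∸ d

infix 4 _≈_
-- Equality after every common shift: this permits replacing `p` by `r` in `dawson p` and also
-- inside `dawson (p + suc q)`.
_≈_ : ℕ → ℕ → Set
p ≈ r = ∀ t → dawson (p + t) ≡ dawson (r + t)

≈-small : ∀ p → 1 ≤ p → ∃[ r ] (r < 88 × 1 ≤ r × p ≈ r)
≈-small p 1≤p with p <? 54
... | yes p<54 = p , ℕ.<-≤-trans p<54 (ℕ.m≤m+n 54 34) , 1≤p , λ _ → refl
... | no  p≮54 with reduce-mod34 54 (ℕ.≮⇒≥ p≮54)
... | r , k , 54≤r , r<88 , refl = r , r<88 , ℕ.≤-trans (s≤s z≤n) 54≤r , λ t → begin
    dawson (r + k * 34 + t)   ≡⟨ cong dawson (shuffle t) ⟩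
    dawson (r + t + k * 34)   ≡⟨ dawson-shift k (ℕ.≤-trans 54≤r (ℕ.m≤m+n r t)) ⟩
    dawson (r + t)            ∎
  where
  open ≡-Reasoning
  shuffle : ∀ t → r + k * 34 + t ≡ r + t + k * 34
  shuffle t = trans (ℕ.+-assoc r _ t)
    (trans (cong (r +_) (ℕ.+-comm _ t)) (sym (ℕ.+-assoc r t _)))

dawson-excludes : ∀ {p q} → 1 ≤ p → 1 ≤ q → dawson (p + suc q) ≢ dawson p ⊕ dawson q
dawson-excludes {p} {q} 1≤p 1≤q eq with ≈-small p 1≤p | ≈-small q 1≤q
... | p′ , p′<88 , 1≤p′ , p≈p′ | q′ , q′<88 , 1≤q′ , q≈q′ =
  dawson-excludes-small p′<88 1≤p′ q′<88 1≤q′ (begin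
    -- `_≈_` replaces a left summand only, so the two summands are brought to the left in turn.
    dawson (p′ + suc q′)    ≡⟨ cong dawson (shuffle p′ q′) ⟩
    dawson (q′ + suc p′)    ≡⟨ q≈q′ (suc p′) ⟨
    dawson (q + suc p′)     ≡⟨ cong dawson (shuffle q p′) ⟩
    dawson (p′ + suc q)     ≡⟨ p≈p′ (suc q) ⟨
    dawson (p + suc q)      ≡⟨ eq ⟩
    dawson p ⊕ dawson q     ≡⟨ cong₂ _⊕_ (≈-self p≈p′) (≈-self q≈q′) ⟩
    dawson p′ ⊕ dawson q′   ∎)
  where
  open ≡-Reasoning
  shuffle : ∀ m n → m + suc n ≡ n + suc m
  shuffle m n = trans (ℕ.+-suc m n) (trans (cong suc (ℕ.+-comm m n)) (sym (ℕ.+-suc n m)))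
  ≈-self : ∀ {m n} → m ≈ n → dawson m ≡ dawson n
  ≈-self {m} {n} m≈n = subst₂ (λ x y → dawson x ≡ dawson y) (ℕ.+-identityʳ m) (ℕ.+-identityʳ n) (m≈n 0)

dawson-attains-≺ : ∀ {s} → s < 142 → ∀ {c} → c ≺ dawson s →
  ∃[ p ] ∃[ q ] (1 ≤ p × 1 ≤ q × p + suc q ≡ s × dawson p ⊕ dawson q ≡ c)
dawson-attains-≺ {s} s<142 {c} c≺ with dawson-attains-small s<142 (≺⇒⟦⟧< c≺)
... | p , p<s , 1≤p , 1≤q , eq =
  p , s ∸ suc p , 1≤p , 1≤q , trans (ℕ.+-suc p _) (ℕ.m+[n∸m]≡n p<s) ,
  trans eq (⟦⟧-injective (bits 4 ⟦ c ⟧) c (⟦bits⟧ 4 (⟦⟧<2^ c)))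

dawson-attains : ∀ s {c} → c ≺ dawson s →
  ∃[ p ] ∃[ q ] (1 ≤ p × 1 ≤ q × p + suc q ≡ s × dawson p ⊕ dawson q ≡ c)
dawson-attains s {c} c≺ with s <? 142
... | yes s<142 = dawson-attains-≺ s<142 c≺
... | no  s≮142 with reduce-mod34 108 (ℕ.≤-trans (ℕ.m≤m+n 108 34) (ℕ.≮⇒≥ s≮142))
... | r , k , 108≤r , r<142 , refl
    with dawson-attains-≺ r<142 (subst (c ≺_) (dawson-shift k (ℕ.≤-trans (ℕ.m≤m+n 54 54) 108≤r)) c≺)
... | p , q , 1≤p , 1≤q , refl , c≡ with 54 ≤? p
... | yes 54≤p = p + k * 34 , q , ℕ.≤-trans 1≤p (ℕ.m≤m+n p _) , 1≤q ,
    (begin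
      p + k * 34 + suc q   ≡⟨ ℕ.+-assoc p (k * 34) (suc q) ⟩
      p + (k * 34 + suc q) ≡⟨ cong (p +_) (ℕ.+-comm (k * 34) (suc q)) ⟩
      p + (suc q + k * 34) ≡⟨ ℕ.+-assoc p (suc q) (k * 34) ⟨
      p + suc q + k * 34   ∎) ,
    trans (cong (_⊕ dawson q) (dawson-shift k 54≤p)) c≡
    where open ≡-Reasoning
... | no 54≰p = p , q + k * 34 , 1≤p , ℕ.≤-trans 1≤q (ℕ.m≤m+n q _) ,
    sym (ℕ.+-assoc p (suc q) (k * 34)) ,
    trans (cong (dawson p ⊕_) (dawson-shift k 54≤q)) c≡
    where
    54≤q : 54 ≤ q
    54≤q = ℕ.≮⇒≥ λ q<54 → ℕ.<⇒≱ (ℕ.+-mono-<-≤ (ℕ.≰⇒> 54≰p) q<54) 108≤r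

dawsonGaps : GapValues 4
dawsonGaps = record
  { gap          = dawson
  ; gap-excludes = dawson-excludes
  ; gap-attains  = dawson-attains
  }

-- From 54 on both the table and the residue condition repeat with period 34. The sporadic values 18
-- and 38 come from the zeros at 16 and 36 in the initial segment, which do not recur.
dawson-zero : ∀ {s} → 3 ≤ s →
  (Exceptional (2 + s) → ⟦ dawson s ⟧ ≡ 0) × (⟦ dawson s ⟧ ≡ 0 → Exceptional (2 + s))
dawson-zero {s} 3≤s with s <? 88
... | yes s<88 = dawson-zero-small s<88 3≤s
... | no  s≮88 with reduce-mod34 54 (ℕ.≤-trans (ℕ.m≤m+n 54 34) (ℕ.≮⇒≥ s≮88))
... | r , k , 54≤r , r<88 , refl with dawson-zero-small r<88 (ℕ.≤-trans (ℕ.m≤m+n 3 51) 54≤r)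
... | exceptional⇒0 , 0⇒exceptional =
    (λ e → trans (cong ⟦_⟧ (dawson-shift k 54≤r)) (exceptional⇒0 (reduce e)))
  , (λ eq → unreduce (0⇒exceptional (trans (cong ⟦_⟧ (sym (dawson-shift k 54≤r))) eq)))
  where
  large : ∀ {t} → 54 ≤ t → 2 + t ∉ (18 ∷ 38 ∷ [])
  large 54≤t (here refl)         = contradiction 54≤t (ℕ.<⇒≱ (ℕ.m≤m+n 17 37))
  large 54≤t (there (here refl)) = contradiction 54≤t (ℕ.<⇒≱ (ℕ.m≤m+n 37 17))
  2+s%34≡2+r%34 : (2 + (r + k * 34)) % 34 ≡ (2 + r) % 34
  2+s%34≡2+r%34 = [m+kn]%n≡m%n (2 + r) k 34
  residues = 8 ∷ 12 ∷ 24 ∷ 28 ∷ 32 ∷ []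
  reduce : Exceptional (2 + (r + k * 34)) → Exceptional (2 + r)
  reduce (inj₁ n∈) = contradiction n∈ (large (ℕ.≤-trans 54≤r (ℕ.m≤m+n r _)))
  reduce (inj₂ n∈) = inj₂ (subst (_∈ residues) 2+s%34≡2+r%34 n∈)
  unreduce : Exceptional (2 + r) → Exceptional (2 + (r + k * 34))
  unreduce (inj₁ n∈) = contradiction n∈ (large 54≤r)
  unreduce (inj₂ n∈) = inj₂ (subst (_∈ residues) (sym 2+s%34≡2+r%34) n∈)

-- Shortest paths in the wheel

module _ {n : ℕ} (G : Graph n) where
  open Graph G

  adj⇒≢ : ∀ {u v} → Adj u v → u ≢ v
  adj⇒≢ u~v refl = irrefl refl u~v

  onShortestPath-via : ∀ {u v w} → u ≢ w → ¬ Adj u w → Adj u v → Adj v w → OnShortestPath G u w v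
  onShortestPath-via {u} {v} {w} u≢w ¬u~w u~v v~w =
    2 , u ∷ v ∷ w ∷ [] ,
    ( ( refl , refl , u~v ∷ v~w ∷ [-]
      , (adj⇒≢ u~v ∷ u≢w ∷ []) ∷ (adj⇒≢ v~w ∷ []) ∷ [] ∷ [])
    , shortest ) ,
    there (here refl)
    where
    shortest : ∀ {l} (ys : Vec (Fin n) (suc l)) → IsPath G u w ys → 2 ≤ l
    shortest {0} (_ ∷ [])     (refl , refl , _)           = contradiction refl u≢w
    shortest {1} (_ ∷ _ ∷ []) (refl , refl , a ∷ [-] , _) = contradiction a ¬u~w
    shortest {suc (suc _)} _ _ = s≤s (s≤s z≤n)

-- The wheel has diameter two, so a shortest path has at most one interior vertex.
onShortestPath⁻ : ∀ {m} {u w v : Fin (suc m)} → OnShortestPath (wheel (suc m)) u w v →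
  v ≡ u ⊎ v ≡ w ⊎ (u ≢ w × ¬ WheelAdj u w × WheelAdj u v × WheelAdj v w)
onShortestPath⁻ {u = u} {w} (0 , (_ ∷ []) , ((refl , _) , _) , here v≡) = inj₁ v≡
onShortestPath⁻ (1 , (_ ∷ _ ∷ []) , ((refl , refl , _) , _) , here v≡) = inj₁ v≡
onShortestPath⁻ (1 , (_ ∷ _ ∷ []) , ((refl , refl , _) , _) , there (here v≡)) = inj₂ (inj₁ v≡)
onShortestPath⁻ (2 , (_ ∷ _ ∷ _ ∷ []) , ((refl , refl , _) , _) , here v≡) = inj₁ v≡
onShortestPath⁻ (2 , (_ ∷ _ ∷ _ ∷ []) , ((refl , refl , _) , _) , there (there (here v≡))) =
  inj₂ (inj₁ v≡)
onShortestPath⁻ {m} {u} {w} (2 , (_ ∷ _ ∷ _ ∷ []) ,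
    ((refl , refl , u~v ∷ v~w ∷ [-] , (_ ∷ u≢w ∷ []) ∷ _) , min) , there (here refl)) =
  inj₂ (inj₂ (u≢w , (λ u~w → contradiction
    (min (u ∷ w ∷ []) (refl , refl , u~w ∷ [-] , (u≢w ∷ []) ∷ [] ∷ [])) λ { (s≤s ()) })
  , u~v , v~w))
onShortestPath⁻ {m} {u} {w} (suc (suc (suc k)) , _ , (_ , min) , _) =
  contradiction (diameter u w) λ (_ , l≤2 , ys , path) →
    ℕ.<⇒≱ (s≤s (s≤s (s≤s z≤n))) (ℕ.≤-trans (min ys path) l≤2)
  where
  diameter : ∀ u w → ∃[ l ] (l ≤ 2 × ∃[ ys ] IsPath (wheel (suc m)) {l} u w ys)
  diameter u w with u Fin.≟ w
  diameter u       .u      | yes refl = 0 , z≤n , u ∷ [] , refl , refl , [-] , [] ∷ []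
  diameter zero    zero    | no u≢w = contradiction refl u≢w
  diameter zero    (suc j) | no u≢w =
    1 , s≤s z≤n , zero ∷ suc j ∷ [] , refl , refl , _ ∷ [-] , (u≢w ∷ []) ∷ [] ∷ []
  diameter (suc i) zero    | no u≢w =
    1 , s≤s z≤n , suc i ∷ zero ∷ [] , refl , refl , _ ∷ [-] , (u≢w ∷ []) ∷ [] ∷ []
  diameter (suc i) (suc j) | no u≢w =
    2 , s≤s (s≤s z≤n) , suc i ∷ zero ∷ suc j ∷ [] , refl , refl , _ ∷ _ ∷ [-] ,
    ((λ ()) ∷ u≢w ∷ []) ∷ ((λ ()) ∷ []) ∷ [] ∷ []

-- The cyclic order of the rim

module _ {m : ℕ} where

  -- `CyclicSuc` without the remainder: wrapping around becomes a case of its own.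
  Next : Fin m → Fin m → Set
  Next i j = toℕ j ≡ suc (toℕ i) ⊎ (suc (toℕ i) ≡ m × toℕ j ≡ 0)

  cyclicSuc⇒next : ∀ {i j} → CyclicSuc i j → Next i j
  cyclicSuc⇒next {i} {j} s with ℕ.m≤n⇒m<n∨m≡n (toℕ<n i)
  ... | inj₁ lt = inj₁ (trans s (m<n⇒m%n≡m {{nonZeroIndex i}} lt))
  ... | inj₂ eq = inj₂ (eq , trans s (trans (cong (λ k → _%_ k m {{nonZeroIndex i}}) eq)
                                            (n%n≡0 m {{nonZeroIndex i}})))

  next⇒cyclicSuc : ∀ {i j} → Next i j → CyclicSuc i j
  next⇒cyclicSuc {i} {j} (inj₁ eq) = trans eq (sym (m<n⇒m%n≡m {{nonZeroIndex i}}
    (subst (_< m) eq (toℕ<n j))))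
  next⇒cyclicSuc {i} {j} (inj₂ (eq , j≡0)) = trans j≡0 (sym
    (trans (cong (λ k → _%_ k m {{nonZeroIndex i}}) eq) (n%n≡0 m {{nonZeroIndex i}})))

  next-functional : ∀ {i j k : Fin m} → Next i j → Next i k → j ≡ k
  next-functional n n′ = toℕ-injective
    (trans (next⇒cyclicSuc n) (sym (next⇒cyclicSuc n′)))

  next-injective : ∀ {i j k : Fin m} → Next i k → Next j k → i ≡ j
  next-injective (inj₁ a) (inj₁ b) = toℕ-injective (ℕ.suc-injective (trans (sym a) b))
  next-injective (inj₁ a) (inj₂ (_ , b)) = contradiction (trans (sym b) a) λ ()
  next-injective (inj₂ (_ , a)) (inj₁ b) = contradiction (trans (sym a) b) λ ()
  next-injective (inj₂ (a , _)) (inj₂ (b , _)) =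
    toℕ-injective (ℕ.suc-injective (trans a (sym b)))

  next : ∀ i → ∃[ j ] Next i j
  next i with suc (toℕ i) <? m
  ... | yes lt = fromℕ< lt , inj₁ (toℕ-fromℕ< lt)
  ... | no ¬lt = fromℕ< 0<m , inj₂ (ℕ.≤-antisym (toℕ<n i) (ℕ.≮⇒≥ ¬lt) , toℕ-fromℕ< 0<m)
    where
    0<m : 0 < m
    0<m = ℕ.≤-<-trans z≤n (toℕ<n i)

  prev : ∀ j → ∃[ i ] Next i j
  prev j with toℕ j in eq
  ... | zero  = fromℕ< m-1<m , inj₂ (trans (cong suc (toℕ-fromℕ< m-1<m)) suc-pred , refl)
    where
    suc-pred : suc (pred m) ≡ m
    suc-pred = ℕ.suc-pred m {{nonZeroIndex j}}
    m-1<m : pred m < m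
    m-1<m = ℕ.≤-reflexive suc-pred
  ... | suc k = fromℕ< k<m , inj₁ (cong suc (sym (toℕ-fromℕ< k<m)))
    where
    k<m : k < m
    k<m = ℕ.<-trans (ℕ.n<1+n k) (subst (_< m) eq (toℕ<n j))

  rimAdj⁻ : ∀ {i j} → WheelAdj (suc i) (suc j) → Next i j ⊎ Next j i
  rimAdj⁻ (_ , inj₁ s) = inj₁ (cyclicSuc⇒next s)
  rimAdj⁻ (_ , inj₂ s) = inj₂ (cyclicSuc⇒next s)

-- Legality and independence on the rim

module _ {m : ℕ} where

  Independent : Subset (suc m) → Set
  Independent P = ∀ (i j : Fin m) → Next i j → ¬ (suc i ∈ₛ P × suc j ∈ₛ P)

  -- The center is adjacent to everything, so the ends of a shortest path with an interior vertex
  -- are two rim vertices. If `i` were interior, both ends would be rim neighbours of `i` other than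
  -- `j`; there is only one such vertex. The same holds for `j`.
  ∁-edge-convex : ∀ {i j : Fin m} → Next i j → Convex (wheel (suc m)) (∁ (⁅ suc i ⁆ ∪ ⁅ suc j ⁆))
  ∁-edge-convex {i} {j} i→j u w v u∈ w∈ on = x∉p⇒x∈∁p λ v∈e →
    avoids (x∈p∪q⁻ ⁅ suc i ⁆ ⁅ suc j ⁆ v∈e)
    where
    ∉-edge : ∀ {x} → x ∈ₛ ∁ (⁅ suc i ⁆ ∪ ⁅ suc j ⁆) → x ≢ suc i × x ≢ suc j
    ∉-edge x∈ = (λ { refl → x∈∁p⇒x∉p x∈ (x∈p∪q⁺ (inj₁ (x∈⁅x⁆ _))) })
              , (λ { refl → x∈∁p⇒x∉p x∈ (x∈p∪q⁺ (inj₂ (x∈⁅x⁆ _))) })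

    -- a and b are rim neighbours of i distinct from j, and i has only two rim neighbours.
    oneNeighbourˡ : ∀ {a b : Fin m} → suc a ≢ suc j → suc b ≢ suc j →
      WheelAdj (suc a) (suc i) → WheelAdj (suc i) (suc b) → a ≡ b
    oneNeighbourˡ a≢j b≢j a~i i~b with rimAdj⁻ a~i | rimAdj⁻ i~b
    ... | inj₂ i→a | _        = contradiction (cong suc (next-functional i→a i→j)) a≢j
    ... | _        | inj₁ i→b = contradiction (cong suc (next-functional i→b i→j)) b≢j
    ... | inj₁ a→i | inj₂ b→i = next-injective a→i b→i

    oneNeighbourʳ : ∀ {a b : Fin m} → suc a ≢ suc i → suc b ≢ suc i →
      WheelAdj (suc a) (suc j) → WheelAdj (suc j) (suc b) → a ≡ b
    oneNeighbourʳ a≢i b≢i a~j j~b with rimAdj⁻ a~j | rimAdj⁻ j~b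
    ... | inj₁ a→j | _        = contradiction (cong suc (next-injective a→j i→j)) a≢i
    ... | _        | inj₂ b→j = contradiction (cong suc (next-injective b→j i→j)) b≢i
    ... | inj₂ j→a | inj₁ j→b = next-functional j→a j→b

    interior : ∀ u w v → u ≢ suc i × u ≢ suc j → w ≢ suc i × w ≢ suc j → u ≢ w →
      ¬ WheelAdj u w → WheelAdj u v → WheelAdj v w → v ≡ suc i ⊎ v ≡ suc j → Empty
    interior zero    zero    _ _ _ u≢w _ _ _ _ = u≢w refl
    interior zero    (suc _) _ _ _ _ ¬u~w _ _ _ = ¬u~w _
    interior (suc _) zero    _ _ _ _ ¬u~w _ _ _ = ¬u~w _
    interior (suc a) (suc b) _ (_ , a≢j) (_ , b≢j) u≢w _ u~v v~w (inj₁ refl) =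
      u≢w (cong suc (oneNeighbourˡ a≢j b≢j u~v v~w))
    interior (suc a) (suc b) _ (a≢i , _) (b≢i , _) u≢w _ u~v v~w (inj₂ refl) =
      u≢w (cong suc (oneNeighbourʳ a≢i b≢i u~v v~w))

    avoids : v ∈ₛ ⁅ suc i ⁆ ⊎ v ∈ₛ ⁅ suc j ⁆ → Empty
    avoids v∈e with onShortestPath⁻ on
    ... | inj₁ refl        = x∈∁p⇒x∉p u∈ (x∈p∪q⁺ v∈e)
    ... | inj₂ (inj₁ refl) = x∈∁p⇒x∉p w∈ (x∈p∪q⁺ v∈e)
    ... | inj₂ (inj₂ (u≢w , ¬u~w , u~v , v~w)) =
      interior u w v (∉-edge u∈) (∉-edge w∈) u≢w ¬u~w u~v v~w
        ([ inj₁ ∘ x∈⁅y⁆⇒x≡y _ , inj₂ ∘ x∈⁅y⁆⇒x≡y _ ]′ v∈e)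

  legal⇒independent : ∀ {P} → Legal (wheel (suc m)) P → Independent P
  legal⇒independent {P} legal i j i→j (i∈P , j∈P) =
    x∈∁p⇒x∉p (inHull _ (∁-edge-convex i→j) ∁P⊆) (x∈p∪q⁺ (inj₁ (x∈⁅x⁆ (suc i))))
    where
    inHull : InHull (wheel (suc m)) (∁ P) (suc i)
    inHull = Equivalence.to (∈hull⇔ (wheel (suc m)) (∁ P) (suc i)) (subst (suc i ∈ₛ_) (sym legal) ∈⊤)
    ∁P⊆ : ∁ P ⊆ ∁ (⁅ suc i ⁆ ∪ ⁅ suc j ⁆)
    ∁P⊆ x∈ = x∉p⇒x∈∁p λ x∈e → x∈∁p⇒x∉p x∈
      ([ (λ x∈i → subst (_∈ₛ P) (sym (x∈⁅y⁆⇒x≡y _ x∈i)) i∈P)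
       , (λ x∈j → subst (_∈ₛ P) (sym (x∈⁅y⁆⇒x≡y _ x∈j)) j∈P) ]′ (x∈p∪q⁻ ⁅ suc i ⁆ ⁅ suc j ⁆ x∈e))

  -- j is reached from i by k steps along the rim, b of them wrapping around.
  Steps : ℕ → Fin m → Fin m → Set
  Steps k i j = ∃[ b ] toℕ j + b * m ≡ k + toℕ i

  next⇒steps : ∀ {i j} → Next i j → Steps 1 i j
  next⇒steps (inj₁ eq) = 0 , trans (ℕ.+-identityʳ _) eq
  next⇒steps (inj₂ (eq , j≡0)) = 1 , trans (cong (_+ 1 * m) j≡0) (trans (ℕ.*-identityˡ m) (sym eq))

  steps-next : ∀ {k i j l} → Steps k i j → Next j l → Steps (suc k) i l
  steps-next {k} {i} {j} {l} (b , eq) n with next⇒steps n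
  ... | c , eq′ = c + b , (begin
    toℕ l + (c + b) * m       ≡⟨ cong (toℕ l +_) (ℕ.*-distribʳ-+ m c b) ⟩
    toℕ l + (c * m + b * m)   ≡⟨ ℕ.+-assoc (toℕ l) (c * m) (b * m) ⟨
    toℕ l + c * m + b * m     ≡⟨ cong (_+ b * m) eq′ ⟩
    suc (toℕ j + b * m)       ≡⟨ cong suc eq ⟩
    suc k + toℕ i             ∎)
    where open ≡-Reasoning

  -- A return to `i` makes `suc k` a multiple of `m`, impossible strictly between 0 and `m`.
  steps-acyclic : ∀ {k i} → suc k < m → ¬ Steps (suc k) i i
  steps-acyclic {k} {i} k<m (b , eq)
    with b | ℕ.+-cancelˡ-≡ (toℕ i) _ _ (trans eq (ℕ.+-comm (suc k) (toℕ i)))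
  ... | suc c | eq′ = ℕ.<⇒≱ k<m (subst (m ≤_) eq′ (ℕ.m≤m+n m (c * m)))

  module _ (4≤m : 4 ≤ m) where

    -- A rim of at least four vertices has no directed cycle of length 1, 2 or 3. This keeps the two
    -- rim neighbours of a rim vertex distinct and nonadjacent.
    next-acyclic₁ : ∀ {i : Fin m} → ¬ Next i i
    next-acyclic₁ = steps-acyclic (ℕ.≤-trans (ℕ.m≤m+n 2 2) 4≤m) ∘ next⇒steps

    next-acyclic₂ : ∀ {i j : Fin m} → Next i j → ¬ Next j i
    next-acyclic₂ {i} a b =
      steps-acyclic (ℕ.≤-trans (ℕ.m≤m+n 3 1) 4≤m) (steps-next {1} {i} (next⇒steps a) b)

    next-acyclic₃ : ∀ {i j k : Fin m} → Next i j → Next j k → ¬ Next k i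
    next-acyclic₃ {i} a b c =
      steps-acyclic 4≤m (steps-next {2} {i} (steps-next {1} {i} (next⇒steps a) b) c)

    rimAdj⁺ : ∀ {i j : Fin m} → Next i j → WheelAdj (suc i) (suc j)
    rimAdj⁺ i→j = (λ { refl → next-acyclic₁ i→j }) , inj₁ (next⇒cyclicSuc i→j)

    module _ {a v b : Fin m} (a→v : Next a v) (v→b : Next v b) where

      next²-≢ : suc a ≢ suc b
      next²-≢ refl = next-acyclic₂ a→v v→b

      next²-nonadjacent : ¬ WheelAdj (suc a) (suc b)
      next²-nonadjacent a~b with rimAdj⁻ a~b
      ... | inj₁ a→b = next-acyclic₁ (subst (Next v) (next-functional a→b a→v) v→b)
      ... | inj₂ b→a = next-acyclic₃ a→v v→b b→a

      rim-onShortestPath : OnShortestPath (wheel (suc m)) (suc a) (suc b) (suc v)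
      rim-onShortestPath = onShortestPath-via (wheel (suc m)) next²-≢ next²-nonadjacent
        (rimAdj⁺ a→v) (rimAdj⁺ v→b)

      center-onShortestPath : OnShortestPath (wheel (suc m)) (suc a) (suc b) zero
      center-onShortestPath = onShortestPath-via (wheel (suc m)) next²-≢ next²-nonadjacent _ _

    independent⇒legal : ∀ {P} → Independent P → Legal (wheel (suc m)) P
    independent⇒legal {P} indep = ⊆-antisym ⊆⊤ λ {v} _ →
      Equivalence.from (∈hull⇔ (wheel (suc m)) (∁ P) v) λ K convex ∁P⊆K → all∈ K convex ∁P⊆K v
      where
      module _ (K : Subset (suc m)) (convex : Convex (wheel (suc m)) K) (∁P⊆K : ∁ P ⊆ K) where

        rim∈ : ∀ v → suc v ∈ₛ K
        rim∈ v with suc v ∈ₛ? P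
        ... | no  v∉P = ∁P⊆K (x∉p⇒x∈∁p v∉P)
        ... | yes v∈P with prev v | next v
        ... | a , a→v | b , v→b = convex (suc a) (suc b) (suc v)
          (∁P⊆K (x∉p⇒x∈∁p λ a∈P → indep a v a→v (a∈P , v∈P)))
          (∁P⊆K (x∉p⇒x∈∁p λ b∈P → indep v b v→b (v∈P , b∈P)))
          (rim-onShortestPath a→v v→b)

        all∈ : ∀ v → v ∈ₛ K
        all∈ (suc v) = rim∈ v
        -- The rim vertices 0 and 2 are already in `K` and are not adjacent, so the center lies
        -- between them on a shortest path.
        all∈ zero with next (fromℕ< (ℕ.<-≤-trans (s≤s z≤n) 4≤m))
        ... | v , a→v with next v
        ... | b , v→b = convex _ (suc b) zero (rim∈ _) (rim∈ b) (center-onShortestPath a→v v→b)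

-- Recognising nim-values

mex-unique : ∀ {xs a b} → IsMex xs a → IsMex xs b → a ≡ b
mex-unique {a = a} {b} (a∉ , <a) (b∉ , <b) with ℕ.<-cmp a b
... | tri< a<b _ _ = contradiction (<b a<b) a∉
... | tri≈ _ a≡b _ = a≡b
... | tri> _ _ b<a = contradiction (<a b<a) b∉

module _ (G : Game) where
  open Game G

  nim-isMex : ∀ p {k} → (∀ {q} → q ∈ options p → nim G q ≢ k) →
    (∀ {j} → j < k → ∃[ q ] (q ∈ options p × nim G q ≡ j)) → nim G p ≡ k
  nim-isMex p {k} excludes attains = trans (nim-unfold G p) (mex-unique (mex-isMex _)
    ( (λ k∈ → let q , q∈ , k≡ = ∈-map⁻ (nim G) k∈ in excludes q∈ (sym k≡))
    , (λ j<k → let q , q∈ , ≡j = attains j<k in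
               subst (_∈ List.map (nim G) (options p)) ≡j (∈-map⁺ (nim G) q∈)) ))

  -- Induction along the options: the two hypotheses make an assigned value the mex of the values of
  -- the options. A relation allows for positions without a value, as long as no option of a valued
  -- position is one of them.
  nim-valuation : ∀ {k} (HasValue : Position → Nimber k → Set) →
    (∀ {p q x} → HasValue p x → q ∈ options p → ∃[ y ] (HasValue q y × y ≢ x)) →
    (∀ {p x y} → HasValue p x → y ≺ x → ∃[ q ] (q ∈ options p × HasValue q y)) →
    ∀ p {x} → HasValue p x → nim G p ≡ ⟦ x ⟧
  nim-valuation HasValue excludes attains =
    All.wfRec terminates 0ℓ (λ p → ∀ {x} → HasValue p x → nim G p ≡ ⟦ x ⟧) λ p ih {x} p∶x →
      nim-isMex p
        (λ {q} q∈ q≡x → let y , q∶y , y≢x = excludes p∶x q∈ in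
                        y≢x (⟦⟧-injective y x (trans (sym (ih q∈ q∶y)) q≡x)))
        (λ j<x → let y , y≺x , y≡j = below⟦⟧ x j<x
                     q , q∈ , q∶y = attains p∶x y≺x in
                 q , q∈ , trans (ih q∈ q∶y) y≡j)

-- Subsets as words and cyclic words

↗-++⁻ : ∀ l₁ {l₂ l} → (l₁ ++ l₂) ↗ l →
  (∃[ l₁′ ] (l ≡ l₁′ ++ l₂ × l₁ ↗ l₁′)) ⊎ (∃[ l₂′ ] (l ≡ l₁ ++ l₂′ × l₂ ↗ l₂′))
↗-++⁻ []           m    = inj₂ (_ , refl , m)
↗-++⁻ (false ∷ l₁) here = inj₁ (true ∷ l₁ , refl , here)
↗-++⁻ (b ∷ l₁) (there m) with ↗-++⁻ l₁ m
... | inj₁ (l₁′ , refl , m′) = inj₁ (b ∷ l₁′ , refl , there m′)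
... | inj₂ (l₂′ , refl , m′) = inj₂ (l₂′ , refl , m′)

↗-++ˡ : ∀ {l₁ l₁′} l₂ → l₁ ↗ l₁′ → (l₁ ++ l₂) ↗ (l₁′ ++ l₂)
↗-++ˡ l₂ here      = here
↗-++ˡ l₂ (there m) = there (↗-++ˡ l₂ m)

↗-++ʳ : ∀ l₁ {l₂ l₂′} → l₂ ↗ l₂′ → (l₁ ++ l₂) ↗ (l₁ ++ l₂′)
↗-++ʳ []       m = m
↗-++ʳ (b ∷ l₁) m = there (↗-++ʳ l₁ m)

∪⁅⁆-↗ : ∀ {n} (P : Subset n) v → v ∉ₛ P → toList P ↗ toList (P ∪ ⁅ v ⁆)
∪⁅⁆-↗ (true  ∷ P) zero v∉ = contradiction here v∉
∪⁅⁆-↗ (false ∷ P) zero v∉ =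
  subst (λ Q → toList (false ∷ P) ↗ (true ∷ toList Q)) (sym (∪-identityʳ P)) here
∪⁅⁆-↗ (b ∷ P) (suc v) v∉ =
  subst (λ b′ → toList (b ∷ P) ↗ (b′ ∷ toList (P ∪ ⁅ v ⁆))) (sym (Bool.∨-identityʳ b))
    (there (∪⁅⁆-↗ P v (v∉ ∘ there)))

↗-∪⁅⁆ : ∀ {n} (P : Subset n) {l} → toList P ↗ l → ∃[ v ] (v ∉ₛ P × toList (P ∪ ⁅ v ⁆) ≡ l)
↗-∪⁅⁆ (false ∷ P) here = zero , (λ ()) , cong ((true ∷_) ∘ toList) (∪-identityʳ P)
↗-∪⁅⁆ (b ∷ P) (there m) with ↗-∪⁅⁆ P m
... | v , v∉ , refl = suc v , (λ { (there v∈) → v∉ v∈ }) ,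
                      cong (_∷ toList (P ∪ ⁅ v ⁆)) (Bool.∨-identityʳ b)

module _ {R : Bool → Bool → Set} where

  linked-lookup⁺ : ∀ {k} (r : Vec Bool k) {e} →
    (∀ i j → toℕ j ≡ suc (toℕ i) → R (lookup r i) (lookup r j)) →
    (∀ i → suc (toℕ i) ≡ k → R (lookup r i) e) → Linked R (toList r ++ e ∷ [])
  linked-lookup⁺ []          inner last = [-]
  linked-lookup⁺ (a ∷ [])    inner last = last zero refl ∷ [-]
  linked-lookup⁺ (a ∷ b ∷ r) inner last = inner zero (suc zero) refl ∷
    linked-lookup⁺ (b ∷ r) (λ i j eq → inner (suc i) (suc j) (cong suc eq))
                           (λ i eq → last (suc i) (cong suc eq))

  linked-lookup⁻ : ∀ {k} (r : Vec Bool k) {e} → Linked R (toList r ++ e ∷ []) →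
    (∀ i j → toℕ j ≡ suc (toℕ i) → R (lookup r i) (lookup r j)) ×
    (∀ i → suc (toℕ i) ≡ k → R (lookup r i) e)
  linked-lookup⁻ []       linked       = (λ ()) , λ ()
  linked-lookup⁻ (a ∷ []) (Rae ∷ [-]) = (λ { zero zero () }) , λ { zero _ → Rae }
  linked-lookup⁻ (a ∷ b ∷ r) (Rab ∷ linked) with linked-lookup⁻ (b ∷ r) linked
  ... | inner , last =
    (λ { zero    (suc zero) _  → Rab
       ; (suc i) (suc j)    eq → inner i j (ℕ.suc-injective eq) }) ,
    (λ { (suc i) eq → last i (ℕ.suc-injective eq) })

  linked-glue : ∀ l₁ {e l₂} → Linked R (l₁ ++ e ∷ []) → Linked R (e ∷ l₂) → Linked R (l₁ ++ e ∷ l₂)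
  linked-glue []           _        r = r
  linked-glue (a ∷ [])     (h ∷ _)  r = h ∷ r
  linked-glue (a ∷ b ∷ l₁) (h ∷ l)  r = h ∷ linked-glue (b ∷ l₁) l r

  linked-cut : ∀ l₁ {e l₂} → Linked R (l₁ ++ e ∷ l₂) → Linked R (l₁ ++ e ∷ []) × Linked R (e ∷ l₂)
  linked-cut []           l       = [-] , l
  linked-cut (a ∷ [])     (h ∷ l) = h ∷ [-] , l
  linked-cut (a ∷ b ∷ l₁) (h ∷ l) with linked-cut (b ∷ l₁) l
  ... | l , r = h ∷ l , r

  -- A word ending in its first letter stands for a cyclic word. To open it at `b` instead of `a`,
  -- it is cut at `b` and the pieces are glued at `a`.
  linked-rotate : ∀ a l₁ b l₂ → Linked R (a ∷ l₁ ++ b ∷ l₂ ++ a ∷ []) →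
    Linked R (b ∷ l₂ ++ a ∷ l₁ ++ b ∷ [])
  linked-rotate a l₁ b l₂ l with linked-cut (a ∷ l₁) l
  ... | l , r = linked-glue (b ∷ l₂) r l

module _ {m : ℕ} {c b : Bool} {r : Vec Bool m} where

  independent⇒linked : Independent (c ∷ b ∷ r) → Linked NotBoth (b ∷ toList r ++ b ∷ [])
  independent⇒linked indep = linked-lookup⁺ (b ∷ r)
    (λ i j eq (i∈ , j∈) → indep i j (inj₁ eq)
      (there (Vec.lookup⇒[]= i _ i∈) , there (Vec.lookup⇒[]= j _ j∈)))
    (λ i eq (i∈ , b≡) → indep i zero (inj₂ (eq , refl))
      (there (Vec.lookup⇒[]= i _ i∈) , there (Vec.lookup⇒[]= zero _ b≡)))

  linked⇒independent : Linked NotBoth (b ∷ toList r ++ b ∷ []) → Independent (c ∷ b ∷ r)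
  linked⇒independent linked i j i→j (there i∈ , there j∈) with linked-lookup⁻ (b ∷ r) linked
  linked⇒independent linked i j (inj₁ eq) (there i∈ , there j∈) | inner , _ =
    inner i j eq (Vec.[]=⇒lookup i∈ , Vec.[]=⇒lookup j∈)
  linked⇒independent linked i zero (inj₂ (eq , _)) (there i∈ , there j∈) | _ , last =
    last i eq (Vec.[]=⇒lookup i∈ , Vec.[]=⇒lookup j∈)

-- The rim is a cyclic word, so it can be read from the displayed taken vertex on: first `l₂`, then
-- `l₁`. That same vertex delimits the result at both ends.
independent⇔fits : ∀ {m} {P : Subset (suc m)} {c} l₁ l₂ → toList P ≡ c ∷ l₁ ++ true ∷ l₂ →
  Independent P ⇔ Fits 0 (l₂ ++ l₁)
independent⇔fits {P = c ∷ true ∷ r} [] .(toList r) refl rewrite List.++-identityʳ (toList r) =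
  mk⇔ independent⇒linked linked⇒independent
independent⇔fits {P = c ∷ b ∷ r} (b′ ∷ l₁) l₂ eq
  with refl ← List.∷-injectiveˡ (List.∷-injectiveʳ eq) =
  mk⇔ (λ indep → subst (Linked NotBoth) assoc₂ (linked-rotate b l₁ true l₂
        (subst (Linked NotBoth) (sym assoc₁) (independent⇒linked {r = r} indep))))
      (λ fits → linked⇒independent (subst (Linked NotBoth) assoc₁
        (linked-rotate true l₂ b l₁ (subst (Linked NotBoth) (sym assoc₂) fits))))
  where
  assoc₁ : b ∷ l₁ ++ true ∷ l₂ ++ b ∷ [] ≡ b ∷ toList r ++ b ∷ []
  assoc₁ = cong (b ∷_) (trans (sym (List.++-assoc l₁ (true ∷ l₂) (b ∷ [])))
    (cong (_++ b ∷ []) (sym (List.∷-injectiveʳ (List.∷-injectiveʳ eq)))))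
  assoc₂ : true ∷ l₂ ++ b ∷ l₁ ++ true ∷ [] ≡ true ∷ (l₂ ++ b ∷ l₁) ++ true ∷ []
  assoc₂ = cong (true ∷_) (sym (List.++-assoc l₂ (b ∷ l₁) (true ∷ [])))

-- Cutting the wheel open

-- The vertices of a wheel cut open at a taken rim vertex.  The center becomes
-- the middle of a separate gap of three vertices.
cutOpen : Bool → List Bool → List Bool → List Bool
cutOpen c l₁ l₂ = false ∷ c ∷ false ∷ true ∷ l₂ ++ l₁

cutOpen-fits⁺ : ∀ {c} l₁ l₂ → Fits 0 (l₂ ++ l₁) → Fits 0 (cutOpen c l₁ l₂)
cutOpen-fits⁺ l₁ l₂ fits = (λ ()) ∷ (λ ()) ∷ (λ ()) ∷ (λ ()) ∷ fits

cutOpen-fits⁻ : ∀ {c} l₁ l₂ → Fits 0 (cutOpen c l₁ l₂) → Fits 0 (l₂ ++ l₁)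
cutOpen-fits⁻ l₁ l₂ (_ ∷ _ ∷ _ ∷ _ ∷ fits) = fits

cutOpen-↗⁺ : ∀ {c} l₁ {l₂ l} → (c ∷ l₁ ++ true ∷ l₂) ↗ l → ∃[ c′ ] ∃[ l₁′ ] ∃[ l₂′ ]
  (l ≡ c′ ∷ l₁′ ++ true ∷ l₂′ × cutOpen c l₁ l₂ ↗ cutOpen c′ l₁′ l₂′)
cutOpen-↗⁺ l₁ here = true , l₁ , _ , refl , there here
cutOpen-↗⁺ {c} l₁ {l₂} (there m) with ↗-++⁻ l₁ m
... | inj₁ (l₁′ , refl , m′)       = c , l₁′ , l₂ , refl , there (there (there (there (↗-++ʳ l₂ m′))))
... | inj₂ (_ , refl , there m′) = c , l₁ , _ , refl , there (there (there (there (↗-++ˡ l₁ m′))))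

-- The outer two of the three extra vertices each border a taken one and must stay free. Hence a
-- move in the extra gap can only take its middle, the center.
cutOpen-↗⁻ : ∀ {c} l₁ l₂ {l} → cutOpen c l₁ l₂ ↗ l → Fits 0 l → ∃[ c′ ] ∃[ l₁′ ] ∃[ l₂′ ]
  (l ≡ cutOpen c′ l₁′ l₂′ × (c ∷ l₁ ++ true ∷ l₂) ↗ (c′ ∷ l₁′ ++ true ∷ l₂′))
cutOpen-↗⁻ l₁ l₂ here (¬both ∷ _) = contradiction (refl , refl) ¬both
cutOpen-↗⁻ l₁ l₂ (there here) _ = true , l₁ , l₂ , refl , here
cutOpen-↗⁻ l₁ l₂ (there (there here)) (_ ∷ _ ∷ _ ∷ ¬both ∷ _) = contradiction (refl , refl) ¬both
cutOpen-↗⁻ {c} l₁ l₂ (there (there (there (there m)))) _ with ↗-++⁻ l₂ m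
... | inj₁ (l₂′ , refl , m′) = c , l₁ , l₂′ , refl , there (↗-++ʳ l₁ (there m′))
... | inj₂ (l₁′ , refl , m′) = c , l₁′ , l₂ , refl , there (↗-++ˡ (true ∷ l₂) m′)

-- Values of positions with a taken rim vertex

open Words dawsonGaps

toList-⁅⁆ : ∀ {m} (i : Fin (suc m)) → ∃[ a ] ∃[ b ] (a + b ≡ m ×
  toList ⁅ i ⁆ ≡ List.replicate a false ++ true ∷ List.replicate b false)
toList-⁅⁆ {m} zero = 0 , m , refl , cong (true ∷_) (Vec.toList-replicate m false)
toList-⁅⁆ {suc m} (suc i) with toList-⁅⁆ i
... | a , b , eq , l≡ = suc a , b , cong suc eq , cong (false ∷_) l≡

start : ∀ m → DNTPosition (wheel (suc m))
start m = Game.start (DNT (wheel (suc m)))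

-- Opaque because conversion checking would otherwise compare the games of two equal wheels
-- field by field, including the termination proofs.
opaque
  wheelNim : ∀ m → DNTPosition (wheel (suc m)) → ℕ
  wheelNim m = nim (DNT (wheel (suc m)))

  wheelNim-start : ∀ m → nimValue (DNT (wheel (suc m))) ≡ wheelNim m (start m)
  wheelNim-start m = refl

  wheelNim-isMex : ∀ {m} p {k} → (∀ {q} → q ∈ dntOptions (wheel (suc m)) p → wheelNim m q ≢ k) →
    (∀ {j} → j < k → ∃[ q ] (q ∈ dntOptions (wheel (suc m)) p × wheelNim m q ≡ j)) →
    wheelNim m p ≡ k
  wheelNim-isMex {m} = nim-isMex (DNT (wheel (suc m)))

  wheelNim-valuation : ∀ {m k} (HasValue : DNTPosition (wheel (suc m)) → Nimber k → Set) →
    (∀ {p q x} → HasValue p x → q ∈ dntOptions (wheel (suc m)) p → ∃[ y ] (HasValue q y × y ≢ x)) →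
    (∀ {p x y} → HasValue p x → y ≺ x → ∃[ q ] (q ∈ dntOptions (wheel (suc m)) p × HasValue q y)) →
    ∀ p {x} → HasValue p x → wheelNim m p ≡ ⟦ x ⟧
  wheelNim-valuation {m} = nim-valuation (DNT (wheel (suc m)))

module _ {m : ℕ} (4≤m : 4 ≤ m) where

  -- Any taken rim vertex may serve as the cut. The two positions without one, the empty set and the
  -- center alone, get no value here.
  record HasValue (p : DNTPosition (wheel (suc m))) (x : Nimber 4) : Set where
    constructor hasValue
    field
      {c}     : Bool
      l₁ l₂   : List Bool
      toList≡ : toList (value p) ≡ c ∷ l₁ ++ true ∷ l₂
      word≡   : word 0 (cutOpen c l₁ l₂) ≡ x

  legal : (p : DNTPosition (wheel (suc m))) → Legal (wheel (suc m)) (value p)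
  legal (P , [ l ]) = recompute (legal? (wheel (suc m)) P) l

  position : (P : Subset (suc m)) → Independent P → DNTPosition (wheel (suc m))
  position P indep = P , [ independent⇒legal 4≤m indep ]

  position-fits : (p : DNTPosition (wheel (suc m))) → ∀ {c} l₁ l₂ →
    toList (value p) ≡ c ∷ l₁ ++ true ∷ l₂ → Fits 0 (cutOpen c l₁ l₂)
  position-fits p l₁ l₂ eq = cutOpen-fits⁺ l₁ l₂
    (Equivalence.to (independent⇔fits l₁ l₂ eq) (legal⇒independent (legal p)))

  -- The cut vertex stays taken, so it also opens the option, and the option differs by one move on
  -- the word.
  hasValue-excludes : ∀ {p q x} → HasValue p x → q ∈ dntOptions (wheel (suc m)) p →
    ∃[ y ] (HasValue q y × y ≢ x)
  hasValue-excludes {p} {q} (hasValue l₁ l₂ p≡ refl) q∈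
    with v , v∉p , q≡ ← Equivalence.to (∈-dntOptions⇔ (wheel (suc m)) p q) q∈
    with c′ , l₁′ , l₂′ , l≡ , move ← cutOpen-↗⁺ l₁
      (subst (_↗ toList (value p ∪ ⁅ v ⁆)) p≡ (∪⁅⁆-↗ (value p) v v∉p)) =
    word 0 (cutOpen c′ l₁′ l₂′) , hasValue l₁′ l₂′ q≡′ refl ,
    word-excludes 0 move (position-fits q l₁′ l₂′ q≡′)
    where
    q≡′ = trans (cong toList q≡) l≡

  hasValue-attains : ∀ {p x y} → HasValue p x → y ≺ x →
    ∃[ q ] (q ∈ dntOptions (wheel (suc m)) p × HasValue q y)
  hasValue-attains {p} (hasValue {c} l₁ l₂ p≡ refl) y≺
    with l , move , fits , y≡ ← word-attains (cutOpen c l₁ l₂) (position-fits p l₁ l₂ p≡) y≺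
    with c′ , l₁′ , l₂′ , refl , move′ ← cutOpen-↗⁻ l₁ l₂ move fits
    with v , v∉p , q≡ ← ↗-∪⁅⁆ (value p) (subst (_↗ (c′ ∷ l₁′ ++ true ∷ l₂′)) (sym p≡) move′) =
    q , Equivalence.from (∈-dntOptions⇔ (wheel (suc m)) p q) (v , v∉p , refl) , hasValue l₁′ l₂′ q≡ y≡
    where
    q = position (value p ∪ ⁅ v ⁆)
          (Equivalence.from (independent⇔fits l₁′ l₂′ q≡) (cutOpen-fits⁻ l₁′ l₂′ fits))

  wheelNim-hasValue : ∀ p {x} → HasValue p x → wheelNim m p ≡ ⟦ x ⟧
  wheelNim-hasValue = wheelNim-valuation HasValue hasValue-excludes hasValue-attains

-- The first two moves and the start position

dawson-≡0 : ∀ s → ⟦ dawson s ⟧ ≡ 0 → dawson s ≡ bits 4 0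
dawson-≡0 s = ⟦⟧-injective (dawson s) (bits 4 0)

-- Opened at its only taken vertex, a rim of `suc m` vertices is a single gap of `m`: the `b` free
-- vertices after `i` run on into the `a` before it.
one-rim-word : ∀ {m} c (i : Fin (suc m)) → ∃[ l₁ ] ∃[ l₂ ] (
  toList ⁅ i ⁆ ≡ l₁ ++ true ∷ l₂ ×
  word 0 (cutOpen c l₁ l₂) ≡ word 0 (false ∷ c ∷ false ∷ []) ⊕ dawson m)
one-rim-word c i with toList-⁅⁆ i
... | a , b , refl , i≡ = List.replicate a false , List.replicate b false , i≡ , word≡ c
  where
  open ≡-Reasoning
  zeros≡ : word 0 (List.replicate b false ++ List.replicate a false) ≡ dawson (a + b)
  zeros≡ = begin
    word 0 (List.replicate b false ++ List.replicate a false)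
      ≡⟨ word-zeros 0 b (List.replicate a false) ⟩
    word (b + 0) (List.replicate a false)
      ≡⟨ cong (word (b + 0)) (List.++-identityʳ (List.replicate a false)) ⟨
    word (b + 0) (List.replicate a false ++ [])
      ≡⟨ word-zeros (b + 0) a [] ⟩
    dawson (a + (b + 0))
      ≡⟨ cong (λ t → dawson (a + t)) (ℕ.+-identityʳ b) ⟩
    dawson (a + b)
      ∎
  word≡ : ∀ c → word 0 (cutOpen c (List.replicate a false) (List.replicate b false))
    ≡ word 0 (false ∷ c ∷ false ∷ []) ⊕ dawson (a + b)
  word≡ false = cong (dawson 3 ⊕_) zeros≡
  word≡ true  = trans (cong (λ z → dawson 1 ⊕ (dawson 1 ⊕ z)) zeros≡)
                      (sym (⊕-assoc (dawson 1) (dawson 1) (dawson (a + b))))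

module _ {m : ℕ} (4≤1+m : 4 ≤ suc m) where

  wheelNim-one-rim : ∀ p {c i} → value p ≡ c ∷ ⁅ i ⁆ →
    wheelNim (suc m) p ≡ ⟦ word 0 (false ∷ c ∷ false ∷ []) ⊕ dawson m ⟧
  wheelNim-one-rim p {c} {i} p≡ =
    let l₁ , l₂ , i≡ , word≡ = one-rim-word c i
    in wheelNim-hasValue 4≤1+m p
         (hasValue l₁ l₂ (trans (cong toList p≡) (cong (c ∷_) i≡)) word≡)

  -- Taking the center splits its gap of three into two gaps of one, which cancel.
  wheelNim-center-rim : ∀ p {i} → value p ≡ true ∷ ⁅ i ⁆ → wheelNim (suc m) p ≡ ⟦ dawson m ⟧
  wheelNim-center-rim p p≡ = trans (wheelNim-one-rim p p≡) (cong ⟦_⟧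
    (trans (⊕-assoc (dawson 1) (dawson 1) (dawson m)) (⊕-selfInverse (dawson 1) (dawson m))))

  wheelNim-rim : ∀ p {i} → value p ≡ false ∷ ⁅ i ⁆ → wheelNim (suc m) p ≡ ⟦ bits 4 1 ⊕ dawson m ⟧
  wheelNim-rim p p≡ = trans (wheelNim-one-rim p p≡) (cong (λ x → ⟦ x ⊕ dawson m ⟧) dawson-3)

  center center-rim₀ : DNTPosition (wheel (suc (suc m)))
  center = position 4≤1+m (true ∷ ∅) λ { i j i→j (there i∈ , _) → ∉⊥ i∈ }
  center-rim₀ = position 4≤1+m (true ∷ ⁅ zero ⁆) λ { i j i→j (there i∈ , there j∈) →
    next-acyclic₁ 4≤1+m (subst₂ Next (x∈⁅y⁆⇒x≡y zero i∈) (x∈⁅y⁆⇒x≡y zero j∈) i→j) }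

  wheelNim-center-options : ∀ {q} → q ∈ dntOptions (wheel (suc (suc m))) center →
    wheelNim (suc m) q ≡ ⟦ dawson m ⟧
  wheelNim-center-options {q} q∈ =
    cases (Equivalence.to (∈-dntOptions⇔ (wheel (suc (suc m))) center q) q∈)
    where
    cases : ∃[ v ] (v ∉ₛ true ∷ ∅ × value q ≡ (true ∷ ∅) ∪ ⁅ v ⁆) → wheelNim (suc m) q ≡ ⟦ dawson m ⟧
    cases (zero  , v∉ , _)  = contradiction here v∉
    cases (suc i , _  , q≡) = wheelNim-center-rim q (trans q≡ (cong (true ∷_) (∪-identityˡ ⁅ i ⁆)))

  center-rim₀∈ : center-rim₀ ∈ dntOptions (wheel (suc (suc m))) center
  center-rim₀∈ = Equivalence.from (∈-dntOptions⇔ (wheel (suc (suc m))) center center-rim₀)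
    (suc zero , (λ { (there i∈) → ∉⊥ i∈ }) , cong (true ∷_) (sym (∪-identityˡ ⁅ zero ⁆)))

  start-options : ∀ {q} → q ∈ dntOptions (wheel (suc (suc m))) (start (suc m)) →
    q ≡ center ⊎ (∃[ i ] value q ≡ false ∷ ⁅ i ⁆)
  start-options {q} q∈ =
    cases (Equivalence.to (∈-dntOptions⇔ (wheel (suc (suc m))) (start (suc m)) q) q∈)
    where
    cases : ∃[ v ] (v ∉ₛ ∅ × value q ≡ ∅ ∪ ⁅ v ⁆) → q ≡ center ⊎ (∃[ i ] value q ≡ false ∷ ⁅ i ⁆)
    cases (zero  , _ , q≡) = inj₁ (value-injective (trans q≡ (cong (true ∷_) (∪-identityˡ ∅))))
    cases (suc i , _ , q≡) = inj₂ (i , trans q≡ (cong (false ∷_) (∪-identityˡ ⁅ i ⁆)))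

  center∈ : center ∈ dntOptions (wheel (suc (suc m))) (start (suc m))
  center∈ = Equivalence.from (∈-dntOptions⇔ (wheel (suc (suc m))) (start (suc m)) center)
    (zero , ∉⊥ , cong (true ∷_) (sym (∪-identityˡ ∅)))

  -- Every first move leads to value 1: the center because all replies to it have value 0, a rim
  -- vertex because the untouched gap of the center adds 1 to 0.
  wheelNim-start≡0 : ⟦ dawson m ⟧ ≡ 0 → wheelNim (suc m) (start (suc m)) ≡ 0
  wheelNim-start≡0 f≡0 = wheelNim-isMex _ excludes λ ()
    where
    wheelNim-center : wheelNim (suc m) center ≡ 1
    wheelNim-center = wheelNim-isMex center
      (λ q∈ q≡1 → contradiction (trans (sym q≡1) (trans (wheelNim-center-options q∈) f≡0)) λ ())
      (λ { (s≤s z≤n) → center-rim₀ , center-rim₀∈ , trans (wheelNim-center-options center-rim₀∈) f≡0 })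
    excludes : ∀ {q} → q ∈ dntOptions (wheel (suc (suc m))) (start (suc m)) → wheelNim (suc m) q ≢ 0
    excludes {q} q∈ q≡0 with start-options q∈
    ... | inj₁ refl = contradiction (trans (sym q≡0) wheelNim-center) λ ()
    ... | inj₂ (i , q≡) = contradiction
      (trans (sym q≡0) (trans (wheelNim-rim q q≡)
        (cong (λ x → ⟦ bits 4 1 ⊕ x ⟧) (dawson-≡0 m f≡0)))) λ ()

  -- Taking the center leads to value 0, as all replies have the nonzero value of `dawson m`. A rim
  -- vertex leads to the nim-sum of 1 and a nonzero value, which is not 1.
  wheelNim-start≡1 : ⟦ dawson m ⟧ ≢ 0 → wheelNim (suc m) (start (suc m)) ≡ 1
  wheelNim-start≡1 f≢0 = wheelNim-isMex _ excludes λ { (s≤s z≤n) → center , center∈ , wheelNim-center }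
    where
    wheelNim-center : wheelNim (suc m) center ≡ 0
    wheelNim-center = wheelNim-isMex center
      (λ q∈ q≡0 → f≢0 (trans (sym (wheelNim-center-options q∈)) q≡0)) λ ()
    excludes : ∀ {q} → q ∈ dntOptions (wheel (suc (suc m))) (start (suc m)) → wheelNim (suc m) q ≢ 1
    excludes {q} q∈ q≡1 with start-options q∈
    ... | inj₁ refl = contradiction (trans (sym q≡1) wheelNim-center) λ ()
    ... | inj₂ (i , q≡) = f≢0 (cong ⟦_⟧ (⊕-cancelˡ (bits 4 1)
      (⟦⟧-injective (bits 4 1 ⊕ dawson m) (bits 4 1) (trans (sym (wheelNim-rim q q≡)) q≡1))))

theorem5p24 : ∀ (n : ℕ) → 5 ≤ n →
    let exceptional = n ∈ (18 ∷ 38 ∷ []) ⊎ n % 34 ∈ (8 ∷ 12 ∷ 24 ∷ 28 ∷ 32 ∷ [])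
    in (exceptional → nimValue (DNT (wheel n)) ≡ 0)
    × (¬ exceptional → nimValue (DNT (wheel n)) ≡ 1)
-- Of the two vertices split off, one is the center and one the rim vertex at which the wheel is
-- opened; `m` vertices remain in the gap.
theorem5p24 (suc (suc m)) (s≤s 4≤1+m) =
    (λ e → trans start≡ (wheelNim-start≡0 4≤1+m (proj₁ (dawson-zero 3≤m) e)))
  , (λ ¬e → trans start≡ (wheelNim-start≡1 4≤1+m (¬e ∘ proj₂ (dawson-zero 3≤m))))
  where
  3≤m : 3 ≤ m
  3≤m = s≤s⁻¹ 4≤1+m
  start≡ = wheelNim-start (suc m)
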